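{- For all integers $k\ge 0$, \[ T_k(t,q)=\sum_{j=0}^k \sum_{i=0}^j (-1)^{j+i}\, t^{2i} q^{j^2+i^2+i} \genfrac{[}{]}{0pt}{}{k-j}{i}_{q^2} \left( \genfrac{[}{]}{0pt}{}{k-i}{j-i}_{q^2} + t \genfrac{[}{]}{0pt}{}{k-i-1}{j-i-1}_{q^2} \right). \]
   Context: The polynomials $T_k(t,q)$ in the indeterminates $t,q$ are defined by $T_0(t,q)=1$ and, for $k\ge1$, \[ T_k(t,q) = T_{k-1}(t,q) + (1+t)(-q)^{k^2} + (1-t^2) \sum_{i=1}^{k-1} (-q)^{k^2-i^2}\, T_{i-1}(t,q). \] For $0\le m\le n$ the $q$-binomial coefficient is $\genfrac{[}{]}{0pt}{}{n}{m}_{q}=\frac{(q;q)_n}{(q;q)_m(q;q)_{n-m}}$ with $(a;q)_n=\prod_{l=0}^{n-1}(1-aq^l)$; the subscript $q^2$ means $q$ is replaced by $q^2$. By convention $\genfrac{[}{]}{0pt}{}{n}{m}_{q}=0$ if $m<0$ (for any integer $n$, including $n=-1$) or if $m>n\ge 0$. -}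

module Defs where

open import Level using (0ℓ)
open import Algebra.Bundles using (CommutativeRing; RawRing; Semiring)
import Algebra.Definitions as AlgebraicDefinitions
import Algebra.Definitions.RawSemiring as RawSemiringDefinitions
import Algebra.Properties.Ring as RingProperties
import Algebra.Properties.CommutativeSemigroup as CommutativeSemigroupProperties
open import Data.Bool.Base using (if_then_else_)
open import Data.Empty using (⊥-elim)
open import Data.Fin.Base using (toℕ)
open import Data.Integer.Base as ℤ using (ℤ; +_; -[1+_])
import Data.Integer.Properties as ℤ
open import Data.List.Base using (List; []; _∷_; map)
open import Data.Nat.Base as ℕ using (ℕ; zero; suc; _∸_)
open import Data.Product.Base using (_,_)
import Relation.Binary.Reasoning.Setoid as SetoidReasoning
open import Relation.Binary.Structures using (IsEquivalence)
open import Relation.Nullary.Decidable.Core using (Dec; yes; no)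
open import Relation.Nullary.Negation.Core using (¬_)

record IntegralDomain : Set₁ where
  field
    commutativeRing : CommutativeRing 0ℓ 0ℓ
  open CommutativeRing commutativeRing public
  open AlgebraicDefinitions _≈_ using (AlmostLeftCancellative)
  field
    1≉0               : ¬ 1# ≈ 0#
    *-cancelˡ-nonZero : AlmostLeftCancellative 0# _*_
    ≈0?               : ∀ x → Dec (x ≈ 0#)

  *-nonZero : ∀ {x y} → ¬ x ≈ 0# → ¬ y ≈ 0# → ¬ x * y ≈ 0#
  *-nonZero {x} {y} x≉0 y≉0 xy≈0 =
    y≉0 (*-cancelˡ-nonZero x y 0# x≉0 (trans xy≈0 (sym (zeroʳ x))))

ℤ-domain : IntegralDomain
ℤ-domain = record
  { commutativeRing   = ℤ.+-*-commutativeRing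
  ; 1≉0               = λ ()
  ; *-cancelˡ-nonZero = λ x y z x≢0 → ℤ.*-cancelˡ-≡ x y z {{ℤ.≢-nonZero x≢0}}
  ; ≈0?               = λ x → x ℤ.≟ ℤ.0ℤ
  }

-- Univariate polynomials as coefficient lists, constant term first.
-- Trailing zeros are allowed; equality is coefficientwise.
module Polynomial (R : CommutativeRing 0ℓ 0ℓ) where

  open CommutativeRing R
  open RingProperties ring using (-0#≈0#)
  module +-Semigroup = CommutativeSemigroupProperties
    (CommutativeRing.+-commutativeSemigroup R)

  Poly : Set
  Poly = List Carrier

  coeff : Poly → ℕ → Carrier
  coeff []      n       = 0#
  coeff (a ∷ p) zero    = a
  coeff (a ∷ p) (suc n) = coeff p n

  infix 4 _≋_
  record _≋_ (p r : Poly) : Set where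
    constructor coeffwise
    field at : ∀ n → coeff p n ≈ coeff r n
  open _≋_ public

  constant : Carrier → Poly
  constant a = a ∷ []

  indeterminate : Poly
  indeterminate = 0# ∷ 1# ∷ []

  infixl 6 _⊕_
  infixl 7 _⊛_ _·_
  infix  8 ⊖_

  _⊕_ : Poly → Poly → Poly
  []      ⊕ r       = r
  (a ∷ p) ⊕ []      = a ∷ p
  (a ∷ p) ⊕ (b ∷ r) = a + b ∷ p ⊕ r

  ⊖_ : Poly → Poly
  ⊖_ = map (-_)

  _·_ : Carrier → Poly → Poly
  a · p = map (a *_) p

  _⊛_ : Poly → Poly → Poly
  []      ⊛ r = []
  (a ∷ p) ⊛ r = a · r ⊕ (0# ∷ p ⊛ r)

  ≋-refl : ∀ {p} → p ≋ p
  ≋-refl .at n = refl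

  ≋-sym : ∀ {p r} → p ≋ r → r ≋ p
  ≋-sym e .at n = sym (at e n)

  ≋-trans : ∀ {p r s} → p ≋ r → r ≋ s → p ≋ s
  ≋-trans e f .at n = trans (at e n) (at f n)

  ≋-isEquivalence : IsEquivalence _≋_
  ≋-isEquivalence = record { refl = ≋-refl ; sym = ≋-sym ; trans = ≋-trans }

  ∷-cong : ∀ {a b p r} → a ≈ b → p ≋ r → a ∷ p ≋ b ∷ r
  ∷-cong e f .at zero    = e
  ∷-cong e f .at (suc n) = at f n

  tail-cong : ∀ {a b p r} → a ∷ p ≋ b ∷ r → p ≋ r
  tail-cong e .at n = at e (suc n)

  tail-zero : ∀ {a p} → a ∷ p ≋ [] → p ≋ []
  tail-zero e .at n = at e (suc n)

  ∷-zero : ∀ {a p} → a ≈ 0# → p ≋ [] → a ∷ p ≋ []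
  ∷-zero e f .at zero    = e
  ∷-zero e f .at (suc n) = at f n

  coeff-⊕ : ∀ p r n → coeff (p ⊕ r) n ≈ coeff p n + coeff r n
  coeff-⊕ []      r       n       = sym (+-identityˡ _)
  coeff-⊕ (a ∷ p) []      n       = sym (+-identityʳ _)
  coeff-⊕ (a ∷ p) (b ∷ r) zero    = refl
  coeff-⊕ (a ∷ p) (b ∷ r) (suc n) = coeff-⊕ p r n

  coeff-⊖ : ∀ p n → coeff (⊖ p) n ≈ - coeff p n
  coeff-⊖ []      n       = sym -0#≈0#
  coeff-⊖ (a ∷ p) zero    = refl
  coeff-⊖ (a ∷ p) (suc n) = coeff-⊖ p n

  coeff-· : ∀ a p n → coeff (a · p) n ≈ a * coeff p n
  coeff-· a []      n       = sym (zeroʳ a)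
  coeff-· a (b ∷ p) zero    = refl
  coeff-· a (b ∷ p) (suc n) = coeff-· a p n

  coeff₀-⊛ : ∀ p r → coeff (p ⊛ r) 0 ≈ coeff p 0 * coeff r 0
  coeff₀-⊛ []      r = sym (zeroˡ _)
  coeff₀-⊛ (a ∷ p) r = trans (coeff-⊕ (a · r) _ 0)
    (trans (+-identityʳ _) (coeff-· a r 0))

  ⊕-cong : ∀ {p p′ r r′} → p ≋ p′ → r ≋ r′ → p ⊕ r ≋ p′ ⊕ r′
  ⊕-cong {p} {p′} {r} {r′} e f .at n = trans (coeff-⊕ p r n)
    (trans (+-cong (at e n) (at f n)) (sym (coeff-⊕ p′ r′ n)))

  ⊖-cong : ∀ {p r} → p ≋ r → ⊖ p ≋ ⊖ r
  ⊖-cong {p} {r} e .at n =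
    trans (coeff-⊖ p n) (trans (-‿cong (at e n)) (sym (coeff-⊖ r n)))

  ·-cong : ∀ {a b p r} → a ≈ b → p ≋ r → a · p ≋ b · r
  ·-cong {a} {b} {p} {r} e f .at n =
    trans (coeff-· a p n) (trans (*-cong e (at f n)) (sym (coeff-· b r n)))

  ⊕-assoc : ∀ p r s → (p ⊕ r) ⊕ s ≋ p ⊕ (r ⊕ s)
  ⊕-assoc p r s .at n = begin
    coeff ((p ⊕ r) ⊕ s) n                 ≈⟨ coeff-⊕ (p ⊕ r) s n ⟩
    coeff (p ⊕ r) n + coeff s n           ≈⟨ +-congʳ (coeff-⊕ p r n) ⟩
    coeff p n + coeff r n + coeff s n     ≈⟨ +-assoc _ _ _ ⟩
    coeff p n + (coeff r n + coeff s n)   ≈⟨ +-congˡ (coeff-⊕ r s n) ⟨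
    coeff p n + coeff (r ⊕ s) n           ≈⟨ coeff-⊕ p (r ⊕ s) n ⟨
    coeff (p ⊕ (r ⊕ s)) n                 ∎
    where open SetoidReasoning setoid

  ⊕-comm : ∀ p r → p ⊕ r ≋ r ⊕ p
  ⊕-comm p r .at n =
    trans (coeff-⊕ p r n) (trans (+-comm _ _) (sym (coeff-⊕ r p n)))

  ⊕-identityʳ : ∀ p → p ⊕ [] ≋ p
  ⊕-identityʳ p .at n = trans (coeff-⊕ p [] n) (+-identityʳ _)

  ⊖-inverseʳ : ∀ p → p ⊕ ⊖ p ≋ []
  ⊖-inverseʳ p .at n = trans (coeff-⊕ p (⊖ p) n)
    (trans (+-congˡ (coeff-⊖ p n)) (-‿inverseʳ _))

  ⊕-interchange : ∀ p r s u → (p ⊕ r) ⊕ (s ⊕ u) ≋ (p ⊕ s) ⊕ (r ⊕ u)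
  ⊕-interchange p r s u .at n = begin
    coeff ((p ⊕ r) ⊕ (s ⊕ u)) n                           ≈⟨ expand p r s u ⟩
    (coeff p n + coeff r n) + (coeff s n + coeff u n)     ≈⟨ +-Semigroup.interchange _ _ _ _ ⟩
    (coeff p n + coeff s n) + (coeff r n + coeff u n)     ≈⟨ expand p s r u ⟨
    coeff ((p ⊕ s) ⊕ (r ⊕ u)) n                           ∎
    where
    open SetoidReasoning setoid
    expand : ∀ p r s u → coeff ((p ⊕ r) ⊕ (s ⊕ u)) n ≈
                         (coeff p n + coeff r n) + (coeff s n + coeff u n)
    expand p r s u = trans (coeff-⊕ (p ⊕ r) (s ⊕ u) n)
      (+-cong (coeff-⊕ p r n) (coeff-⊕ s u n))

  ·-zero : ∀ {a} r → a ≈ 0# → a · r ≋ []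
  ·-zero {a} r e .at n = trans (coeff-· a r n) (trans (*-congʳ e) (zeroˡ _))

  ·-identity : ∀ p → 1# · p ≋ p
  ·-identity p .at n = trans (coeff-· 1# p n) (*-identityˡ _)

  ·-distribˡ : ∀ a p r → a · (p ⊕ r) ≋ a · p ⊕ a · r
  ·-distribˡ a p r .at n = begin
    coeff (a · (p ⊕ r)) n               ≈⟨ coeff-· a (p ⊕ r) n ⟩
    a * coeff (p ⊕ r) n                 ≈⟨ *-congˡ (coeff-⊕ p r n) ⟩
    a * (coeff p n + coeff r n)         ≈⟨ distribˡ _ _ _ ⟩
    a * coeff p n + a * coeff r n       ≈⟨ +-cong (coeff-· a p n) (coeff-· a r n) ⟨
    coeff (a · p) n + coeff (a · r) n   ≈⟨ coeff-⊕ (a · p) (a · r) n ⟨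
    coeff (a · p ⊕ a · r) n             ∎
    where open SetoidReasoning setoid

  ·-distribʳ : ∀ a b p → (a + b) · p ≋ a · p ⊕ b · p
  ·-distribʳ a b p .at n = begin
    coeff ((a + b) · p) n               ≈⟨ coeff-· (a + b) p n ⟩
    (a + b) * coeff p n                 ≈⟨ distribʳ _ _ _ ⟩
    a * coeff p n + b * coeff p n       ≈⟨ +-cong (coeff-· a p n) (coeff-· b p n) ⟨
    coeff (a · p) n + coeff (b · p) n   ≈⟨ coeff-⊕ (a · p) (b · p) n ⟨
    coeff (a · p ⊕ b · p) n             ∎
    where open SetoidReasoning setoid

  ·-assoc : ∀ a b p → (a * b) · p ≋ a · (b · p)
  ·-assoc a b p .at n = begin
    coeff ((a * b) · p) n   ≈⟨ coeff-· (a * b) p n ⟩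
    a * b * coeff p n       ≈⟨ *-assoc _ _ _ ⟩
    a * (b * coeff p n)     ≈⟨ *-congˡ (coeff-· b p n) ⟨
    a * coeff (b · p) n     ≈⟨ coeff-· a (b · p) n ⟨
    coeff (a · (b · p)) n   ∎
    where open SetoidReasoning setoid

  ⊛-zero : ∀ {p} r → p ≋ [] → p ⊛ r ≋ []
  ⊛-zero {[]}    r e = ≋-refl
  ⊛-zero {a ∷ p} r e =
    ⊕-cong (·-zero r (at e 0)) (∷-zero refl (⊛-zero r (tail-zero e)))

  ⊛-congʳ : ∀ {p p′} r → p ≋ p′ → p ⊛ r ≋ p′ ⊛ r
  ⊛-congʳ {[]}    {p′}    r e = ≋-sym (⊛-zero r (≋-sym e))
  ⊛-congʳ {a ∷ p} {[]}    r e = ⊛-zero r e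
  ⊛-congʳ {a ∷ p} {b ∷ s} r e =
    ⊕-cong (·-cong (at e 0) ≋-refl) (∷-cong refl (⊛-congʳ r (tail-cong e)))

  ⊛-congˡ : ∀ p {r r′} → r ≋ r′ → p ⊛ r ≋ p ⊛ r′
  ⊛-congˡ []      e = ≋-refl
  ⊛-congˡ (a ∷ p) e = ⊕-cong (·-cong refl e) (∷-cong refl (⊛-congˡ p e))

  ⊛-cong : ∀ {p p′ r r′} → p ≋ p′ → r ≋ r′ → p ⊛ r ≋ p′ ⊛ r′
  ⊛-cong {p} {p′} {r} e f = ≋-trans (⊛-congʳ r e) (⊛-congˡ p′ f)

  0∷-⊕ : ∀ p r → 0# ∷ (p ⊕ r) ≋ (0# ∷ p) ⊕ (0# ∷ r)
  0∷-⊕ p r = ∷-cong (sym (+-identityʳ 0#)) ≋-refl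

  ⊛-distribʳ : ∀ s p r → (p ⊕ r) ⊛ s ≋ p ⊛ s ⊕ r ⊛ s
  ⊛-distribʳ s []      r       = ≋-refl
  ⊛-distribʳ s (a ∷ p) []      = ≋-sym (⊕-identityʳ _)
  ⊛-distribʳ s (a ∷ p) (b ∷ r) = ≋-trans
    (⊕-cong (·-distribʳ a b s)
      (≋-trans (∷-cong refl (⊛-distribʳ s p r)) (0∷-⊕ (p ⊛ s) (r ⊛ s))))
    (⊕-interchange (a · s) (b · s) (0# ∷ p ⊛ s) (0# ∷ r ⊛ s))

  ·-⊛-assoc : ∀ a p r → (a · p) ⊛ r ≋ a · (p ⊛ r)
  ·-⊛-assoc a []      r = ≋-refl
  ·-⊛-assoc a (b ∷ p) r = ≋-trans
    (⊕-cong (·-assoc a b r) (∷-cong (sym (zeroʳ a)) (·-⊛-assoc a p r)))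
    (≋-sym (·-distribˡ a (b · r) (0# ∷ p ⊛ r)))

  0∷-⊛ : ∀ p r → (0# ∷ p) ⊛ r ≋ 0# ∷ p ⊛ r
  0∷-⊛ p r = ⊕-cong (·-zero r refl) ≋-refl

  ⊛-assoc : ∀ p r s → (p ⊛ r) ⊛ s ≋ p ⊛ (r ⊛ s)
  ⊛-assoc []      r s = ≋-refl
  ⊛-assoc (a ∷ p) r s = ≋-trans (⊛-distribʳ s (a · r) (0# ∷ p ⊛ r))
    (⊕-cong (·-⊛-assoc a r s)
      (≋-trans (0∷-⊛ (p ⊛ r) s) (∷-cong refl (⊛-assoc p r s))))

  ⊛-zeroʳ : ∀ p → p ⊛ [] ≋ []
  ⊛-zeroʳ []      = ≋-refl
  ⊛-zeroʳ (a ∷ p) = ∷-zero refl (⊛-zeroʳ p)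

  ⊛-∷ : ∀ p b r → p ⊛ (b ∷ r) ≋ b · p ⊕ (0# ∷ p ⊛ r)
  ⊛-∷ []      b r = ≋-sym (∷-zero refl ≋-refl)
  ⊛-∷ (a ∷ p) b r = ∷-cong (+-congʳ (*-comm a b))
    (≋-trans (⊕-cong ≋-refl (⊛-∷ p b r))
    (≋-trans (≋-sym (⊕-assoc (a · r) (b · p) _))
    (≋-trans (⊕-cong (⊕-comm (a · r) (b · p)) ≋-refl)
             (⊕-assoc (b · p) (a · r) _))))

  ⊛-comm : ∀ p r → p ⊛ r ≋ r ⊛ p
  ⊛-comm []      r = ≋-sym (⊛-zeroʳ r)
  ⊛-comm (a ∷ p) r = ≋-trans (⊕-cong ≋-refl (∷-cong refl (⊛-comm p r)))
    (≋-sym (⊛-∷ r a p))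

  ⊛-identityˡ : ∀ p → constant 1# ⊛ p ≋ p
  ⊛-identityˡ p = ≋-trans
    (⊕-cong (·-identity p) (∷-zero refl ≋-refl)) (⊕-identityʳ p)

  polyRing : CommutativeRing 0ℓ 0ℓ
  polyRing = record
    { Carrier = Poly
    ; _≈_     = _≋_
    ; _+_     = _⊕_
    ; _*_     = _⊛_
    ; -_      = ⊖_
    ; 0#      = []
    ; 1#      = constant 1#
    ; isCommutativeRing = record
      { isRing = record
        { +-isAbelianGroup = record
          { isGroup = record
            { isMonoid = record
              { isSemigroup = record
                { isMagma = record { isEquivalence = ≋-isEquivalence ; ∙-cong = ⊕-cong }
                ; assoc   = ⊕-assoc
                }
              ; identity = (λ p → ≋-refl) , ⊕-identityʳ
              }
            ; inverse = (λ p → ≋-trans (⊕-comm (⊖ p) p) (⊖-inverseʳ p)) , ⊖-inverseʳ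
            ; ⁻¹-cong = ⊖-cong
            }
          ; comm = ⊕-comm
          }
        ; *-cong     = ⊛-cong
        ; *-assoc    = ⊛-assoc
        ; *-identity = ⊛-identityˡ ,
                       λ p → ≋-trans (⊛-comm p (constant 1#)) (⊛-identityˡ p)
        ; distrib    = (λ s p r → ≋-trans (⊛-comm s (p ⊕ r))
                         (≋-trans (⊛-distribʳ s p r)
                                  (⊕-cong (⊛-comm p s) (⊛-comm r s))))
                     , ⊛-distribʳ
        }
      ; *-comm = ⊛-comm
      }
    }

module _ (D : IntegralDomain) where
  open IntegralDomain D hiding (commutativeRing)
  open Polynomial (IntegralDomain.commutativeRing D)

  private
    module P = CommutativeRing polyRing
    open RingProperties P.ring using (x[y-z]≈xy-xz; x∙y⁻¹≈ε⇒x≈y)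

    ≋0? : ∀ p → Dec (p ≋ [])
    ≋0? []      = yes ≋-refl
    ≋0? (a ∷ p) with ≈0? a | ≋0? p
    ... | no  a≉0 | _       = no λ e → a≉0 (at e 0)
    ... | yes _   | no  p≉0 = no λ e → p≉0 (tail-zero e)
    ... | yes a≈0 | yes p≈0 = yes (∷-zero a≈0 p≈0)

    noZeroDivisors : ∀ p r → ¬ p ≋ [] → p ⊛ r ≋ [] → r ≋ []
    noZeroDivisors []      r p≉0 e = ⊥-elim (p≉0 ≋-refl)
    noZeroDivisors (a ∷ p) r p≉0 e with ≈0? a
    ... | yes a≈0 = noZeroDivisors p r (λ p≈0 → p≉0 (∷-zero a≈0 p≈0))
            (tail-zero (≋-trans (≋-sym (⊕-cong (·-zero r a≈0) ≋-refl)) e))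
    ... | no a≉0 = go r e
      where
      go : ∀ r → (a ∷ p) ⊛ r ≋ [] → r ≋ []
      go []      e = ≋-refl
      go (b ∷ r) e = ∷-zero b≈0 (go r (tail-zero (≋-trans (≋-sym step) e)))
        where
        b≈0 : b ≈ 0#
        b≈0 = *-cancelˡ-nonZero a b 0# a≉0
          (trans (sym (+-identityʳ _)) (trans (at e 0) (sym (zeroʳ a))))
        step : (a ∷ p) ⊛ (b ∷ r) ≋ 0# ∷ (a ∷ p) ⊛ r
        step = ≋-trans (⊛-∷ (a ∷ p) b r) (⊕-cong (·-zero (a ∷ p) b≈0) ≋-refl)

  polynomialDomain : IntegralDomain
  polynomialDomain = record
    { commutativeRing   = polyRing
    ; 1≉0               = λ e → 1≉0 (at e 0)
    ; *-cancelˡ-nonZero = λ p r s p≉0 e → x∙y⁻¹≈ε⇒x≈y r s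
        (noZeroDivisors p (r P.- s) p≉0
          (P.trans (x[y-z]≈xy-xz p r s)
          (P.trans (P.+-congʳ e) (P.-‿inverseʳ (p ⊛ s)))))
    ; ≈0?               = ≋0?
    }

module FieldOfFractions (D : IntegralDomain) where
  open IntegralDomain D

  infix 5 _/_[_]
  record Fraction : Set where
    constructor _/_[_]
    field
      num   : Carrier
      den   : Carrier
      den≉0 : ¬ den ≈ 0#
  open Fraction public

  fractionRing : RawRing 0ℓ 0ℓ
  fractionRing = record
    { Carrier = Fraction
    ; _≈_ = λ x y → num x * den y ≈ num y * den x
    ; _+_ = λ x y → (num x * den y + num y * den x) / den x * den y
                      [ *-nonZero (den≉0 x) (den≉0 y) ]
    ; _*_ = λ x y → num x * num y / den x * den y
                      [ *-nonZero (den≉0 x) (den≉0 y) ]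
    ; -_  = λ x → (- num x) / den x [ den≉0 x ]
    ; 0#  = 0# / 1# [ 1≉0 ]
    ; 1#  = 1# / 1# [ 1≉0 ]
    }

  fromDomain : Carrier → Fraction
  fromDomain a = a / 1# [ 1≉0 ]

-- ℤ[t,q] is encoded as (ℤ[t])[q].
ℤ[t] ℤ[t,q] : IntegralDomain
ℤ[t]   = polynomialDomain ℤ-domain
ℤ[t,q] = polynomialDomain ℤ[t]

private
  module ℤ[t]-polynomials = Polynomial (IntegralDomain.commutativeRing ℤ-domain)
  module ℤ[t,q]-polynomials = Polynomial (IntegralDomain.commutativeRing ℤ[t])

module Polynomials where
  open IntegralDomain ℤ[t,q] public
  open RawSemiringDefinitions (Semiring.rawSemiring semiring) public using (_^_)

  t q : Carrier
  t = ℤ[t,q]-polynomials.constant ℤ[t]-polynomials.indeterminate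
  q = ℤ[t,q]-polynomials.indeterminate

  mutual
    T : ℕ → Carrier
    T zero    = 1#
    T (suc k) = T k + (1# + t) * (- q) ^ (suc k ℕ.^ 2)
                    + (1# - t ^ 2) * tailSum (suc k) k

    -- tailSum k m = Σ_{i=1}^{m} (-q)^(k²-i²) T_{i-1}; only used with m < k,
    -- so that the truncated subtraction is exact.
    tailSum : ℕ → ℕ → Carrier
    tailSum k zero    = 0#
    tailSum k (suc m) = tailSum k m + (- q) ^ (k ℕ.^ 2 ∸ suc m ℕ.^ 2) * T m

  infix 9 ⟨_⨾_⟩_
  -- ⟨ a ⨾ x ⟩ n is the x-Pochhammer symbol (a;x)_n = ∏_{l<n} (1 - a xˡ).
  ⟨_⨾_⟩_ : Carrier → Carrier → ℕ → Carrier
  ⟨ a ⨾ x ⟩ zero  = 1#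
  ⟨ a ⨾ x ⟩ suc n = ⟨ a ⨾ x ⟩ n * (1# - a * x ^ n)

  ⟨q²⨾q²⟩≉0 : ∀ n → ¬ ⟨ q ^ 2 ⨾ q ^ 2 ⟩ n ≈ 0#
  ⟨q²⨾q²⟩≉0 n e = Z.1≉0 (Z.trans (Z.sym (constantTerm n)) (at e 0))
    where
    open ℤ[t,q]-polynomials
    module Z = IntegralDomain ℤ[t]
    open RingProperties Z.ring using (-0#≈0#)

    factor : ∀ l → coeff (1# - q ^ 2 * (q ^ 2) ^ l) 0 Z.≈ Z.1#
    factor l = Z.trans (coeff-⊕ 1# (- (q ^ 2 * (q ^ 2) ^ l)) 0)
      (Z.trans (Z.+-congˡ (Z.trans (coeff-⊖ (q ^ 2 * (q ^ 2) ^ l) 0)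
        (Z.trans (Z.-‿cong (Z.trans (coeff₀-⊛ (q ^ 2) ((q ^ 2) ^ l))
          (Z.trans (Z.*-congʳ {coeff ((q ^ 2) ^ l) 0} (coeff₀-⊛ q (q ^ 1)))
                   (Z.zeroˡ (coeff ((q ^ 2) ^ l) 0)))))
          -0#≈0#)))
        (Z.+-identityʳ Z.1#))

    constantTerm : ∀ n → coeff (⟨ q ^ 2 ⨾ q ^ 2 ⟩ n) 0 Z.≈ Z.1#
    constantTerm zero    = Z.refl
    constantTerm (suc n) =
      Z.trans (coeff₀-⊛ (⟨ q ^ 2 ⨾ q ^ 2 ⟩ n) (1# - q ^ 2 * (q ^ 2) ^ n))
        (Z.trans (Z.*-cong (constantTerm n) (factor n)) (Z.*-identityˡ Z.1#))

open FieldOfFractions ℤ[t,q] public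
  using (Fraction; _/_[_]; num; den; den≉0; fractionRing; fromDomain)

-- In ℚ(t,q).  The case n < 0 ≤ m never occurs in the identity; its value
-- here is an arbitrary choice.
module qBinomial (x : Polynomials.Carrier)
                 (⟨x⨾x⟩≉0 : ∀ n → ¬ Polynomials.⟨ x ⨾ x ⟩ n Polynomials.≈ Polynomials.0#)
                 where
  open Polynomials
  private module F = RawRing fractionRing

  binomial : ℤ → ℤ → Fraction
  binomial n        -[1+ m ] = F.0#
  binomial -[1+ n ] (+ m)    = F.0#
  binomial (+ n)    (+ m)    =
    if m ℕ.≤ᵇ n
    then ⟨ x ⨾ x ⟩ n / ⟨ x ⨾ x ⟩ m * ⟨ x ⨾ x ⟩ (n ∸ m)
           [ *-nonZero (⟨x⨾x⟩≉0 m) (⟨x⨾x⟩≉0 (n ∸ m)) ]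
    else F.0#

T : ℕ → Fraction
T k = fromDomain (Polynomials.T k)

t q : Fraction
t = fromDomain Polynomials.t
q = fromDomain Polynomials.q

[_,_]q² : ℤ → ℤ → Fraction
[ n , m ]q² = qBinomial.binomial (Polynomials.q Polynomials.^ 2) Polynomials.⟨q²⨾q²⟩≉0 n m

open RawRing fractionRing public using (_≈_; _+_; _*_; -_; 0#; 1#)
open RawSemiringDefinitions (RawRing.rawSemiring fractionRing) public using (_^_; sum)

-- ∑[ i ≤ n ] f i ranges over 0 ≤ i ≤ n.
∑≤ : ℕ → (ℕ → Fraction) → Fraction
∑≤ n f = sum {suc n} (λ i → f (toℕ i))

infixl 5 ∑≤
syntax ∑≤ n (λ i → e) = ∑[ i ≤ n ] e

{-# OPTIONS --safe #-}
module Submission where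

-- Write p = q², x = -q, τ = -t².  Subtracting x^{2k+3} times the definition of
-- T_{k+1} from that of T_{k+2} leaves the three-term recurrence
--   T_{k+2} = (1 + x p^{k+1}) T_{k+1} + τ x p^{k+1} T_k.
-- In the double sum put j = i + m.  The product of the two binomials is
-- [n, i] [n-i, m] with n = k - i, so the q-binomial theorem evaluates the sum
-- over m, and the double sum becomes Θ_x(k) + t x Θ_{xp}(k-1) with
--   Θ_w(k) = Σ_{2i+r=k} τ^i w^i p^{i²} [i+r, i] ∏_{l<r} (1 + w p^{i+l}).
-- The two Pascal rules show that Θ_w(k) satisfies the recurrence above with w
-- in place of x; the delayed sum therefore satisfies that of T itself.

open import Defs using (IntegralDomain; ℤ[t,q]; module FieldOfFractions; module Polynomials)
open import Level using (0ℓ)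
open import Algebra.Bundles using (CommutativeSemiring; RawRing)
import Algebra.Definitions.RawSemiring as RawSemiringDefinitions
import Algebra.Properties.CommutativeSemiring.Exp as Exp
import Algebra.Properties.Group as GroupProperties
import Algebra.Properties.Ring as RingProperties
import Algebra.Solver.Ring.NaturalCoefficients.Default as SemiringSolver
open import Data.Bool.Base using (false; true; if_then_else_)
open import Data.Bool.Properties using (T-≡)
open import Data.Fin.Base using (toℕ)
open import Data.Integer.Base as ℤ using (1ℤ)
import Data.Integer.Properties as ℤ
open import Data.Nat.Base as ℕ using (ℕ; zero; suc; z≤n; s≤s; _∸_)
import Data.Nat.Properties as ℕ
open import Data.Nat.Solver using (module +-*-Solver)
open +-*-Solver using ()
  renaming ( solve to ℕ-solve; con to κ; _:=_ to infix 4 _⊜_; _:+_ to infixl 6 _⊞_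
           ; _:*_ to infixl 7 _⊠_; _:^_ to infixr 9 _⊡_)
open import Function.Base using (_∘_)
open import Function.Bundles using (Equivalence)
open import Relation.Binary.PropositionalEquality.Core as ≡ using (_≡_)
import Relation.Binary.Reasoning.Setoid as SetoidReasoning
open import Relation.Nullary.Negation.Core using (¬_; contradiction)

-- Sums over antidiagonals and half-diagonals.

module Sums (R : CommutativeSemiring 0ℓ 0ℓ) where
  open CommutativeSemiring R
  open SemiringSolver R using (solve; _:=_; _:+_; _:*_)
  open SetoidReasoning setoid

  -- antidiagonal f n = Σ_{a+b=n} f a b
  antidiagonal : (ℕ → ℕ → Carrier) → ℕ → Carrier
  antidiagonal f zero    = f 0 0
  antidiagonal f (suc n) = f 0 (suc n) + antidiagonal (f ∘ suc) n

  -- halfDiagonal f n = Σ_{2a+b=n} f a b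
  halfDiagonal : (ℕ → ℕ → Carrier) → ℕ → Carrier
  halfDiagonal f zero          = f 0 0
  halfDiagonal f (suc zero)    = f 0 1
  halfDiagonal f (suc (suc n)) = f 0 (suc (suc n)) + halfDiagonal (f ∘ suc) n

  antidiagonal-cong : ∀ {f g} n → (∀ a b → a ℕ.+ b ≡ n → f a b ≈ g a b) →
                      antidiagonal f n ≈ antidiagonal g n
  antidiagonal-cong zero    e = e 0 0 ≡.refl
  antidiagonal-cong (suc n) e =
    +-cong (e 0 (suc n) ≡.refl) (antidiagonal-cong n λ a b → e (suc a) b ∘ ≡.cong suc)

  antidiagonal-zero : ∀ {f} n → (∀ a b → a ℕ.+ b ≡ n → f a b ≈ 0#) →
                      antidiagonal f n ≈ 0#
  antidiagonal-zero zero    e = e 0 0 ≡.refl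
  antidiagonal-zero (suc n) e = trans
    (+-cong (e 0 (suc n) ≡.refl) (antidiagonal-zero n λ a b → e (suc a) b ∘ ≡.cong suc))
    (+-identityˡ 0#)

  antidiagonal-+ : ∀ f g n → antidiagonal (λ a b → f a b + g a b) n ≈
                             antidiagonal f n + antidiagonal g n
  antidiagonal-+ f g zero    = refl
  antidiagonal-+ f g (suc n) = trans (+-congˡ (antidiagonal-+ (f ∘ suc) (g ∘ suc) n))
    (solve 4 (λ a b c d → (a :+ b) :+ (c :+ d) := (a :+ c) :+ (b :+ d)) refl _ _ _ _)

  antidiagonal-* : ∀ c f n → antidiagonal (λ a b → c * f a b) n ≈ c * antidiagonal f n
  antidiagonal-* c f zero    = refl
  antidiagonal-* c f (suc n) =
    trans (+-congˡ (antidiagonal-* c (f ∘ suc) n)) (sym (distribˡ c _ _))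

  -- Both sides run over all triples with a + b + c = k. For the double sum this puts `i` outside
  -- and leaves an inner sum over m + s = k - i.
  antidiagonal-assoc : ∀ (f : ℕ → ℕ → ℕ → Carrier) k →
    antidiagonal (λ j c → antidiagonal (λ a b → f a b c) j) k ≈
    antidiagonal (λ a n → antidiagonal (λ b c → f a b c) n) k
  antidiagonal-assoc f zero    = refl
  antidiagonal-assoc f (suc k) = begin
    f 0 0 (suc k) + antidiagonal (λ j c → f 0 (suc j) c + antidiagonal (λ a b → f (suc a) b c) j) k
      ≈⟨ +-congˡ (antidiagonal-+ _ _ k) ⟩
    f 0 0 (suc k) + (antidiagonal (λ j c → f 0 (suc j) c) k
      + antidiagonal (λ j c → antidiagonal (λ a b → f (suc a) b c) j) k)
      ≈⟨ +-assoc _ _ _ ⟨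
    f 0 0 (suc k) + antidiagonal (λ j c → f 0 (suc j) c) k
      + antidiagonal (λ j c → antidiagonal (λ a b → f (suc a) b c) j) k
      ≈⟨ +-congˡ (antidiagonal-assoc (f ∘ suc) k) ⟩
    f 0 0 (suc k) + antidiagonal (λ j c → f 0 (suc j) c) k
      + antidiagonal (λ a n → antidiagonal (λ b c → f (suc a) b c) n) k ∎

  antidiagonal-dropʳ : ∀ f n → (∀ a → f a 0 ≈ 0#) →
                       antidiagonal f (suc n) ≈ antidiagonal (λ a b → f a (suc b)) n
  antidiagonal-dropʳ f zero    e = trans (+-congˡ (e 1)) (+-identityʳ _)
  antidiagonal-dropʳ f (suc n) e = +-congˡ (antidiagonal-dropʳ (f ∘ suc) n (e ∘ suc))

  antidiagonal-shiftʳ : ∀ i f n → (∀ a b → b ℕ.< i → f a b ≈ 0#) →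
    antidiagonal f (i ℕ.+ n) ≈ antidiagonal (λ a b → f a (i ℕ.+ b)) n
  antidiagonal-shiftʳ zero    f n e = refl
  antidiagonal-shiftʳ (suc i) f n e = trans
    (antidiagonal-dropʳ f (i ℕ.+ n) (λ a → e a 0 (s≤s z≤n)))
    (antidiagonal-shiftʳ i (λ a b → f a (suc b)) n (λ a b b<i → e a (suc b) (s≤s b<i)))

  -- Pascal's rule, summed: `g` takes the terms with the second index lowered, so its antidiagonal
  -- is one shorter, while `h` keeps the index pair and is alone on the edge b = 0.
  antidiagonal-split : ∀ f g h n →
    (∀ a b → f a (suc b) ≈ g a b + h a (suc b)) → (∀ a → f a 0 ≈ h a 0) →
    antidiagonal f (suc n) ≈ antidiagonal g n + antidiagonal h (suc n)
  antidiagonal-split f g h zero    e e₀ = trans (+-cong (e 0 0) (e₀ 1)) (+-assoc _ _ _)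
  antidiagonal-split f g h (suc n) e e₀ = trans
    (+-cong (e 0 (suc n)) (antidiagonal-split (f ∘ suc) (g ∘ suc) (h ∘ suc) n (e ∘ suc) (e₀ ∘ suc)))
    (solve 4 (λ a b c d → (a :+ b) :+ (c :+ d) := (a :+ c) :+ (b :+ d)) refl _ _ _ _)

  -- Where n < i the terms vanish; elsewhere n = i + r, and i + n = k becomes 2i + r = k. Each
  -- recursive step splits off i = 0, drops the vanishing term at n = 0 and lowers both indices.
  antidiagonal⇒halfDiagonal : ∀ f g k →
    (∀ i n → n ℕ.< i → f i n ≈ 0#) → (∀ i r → f i (i ℕ.+ r) ≈ g i r) →
    antidiagonal f k ≈ halfDiagonal g k
  antidiagonal⇒halfDiagonal f g zero          e₀ e = e 0 0
  antidiagonal⇒halfDiagonal f g (suc zero)    e₀ e =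
    trans (+-cong (e 0 1) (e₀ 1 0 (s≤s z≤n))) (+-identityʳ _)
  antidiagonal⇒halfDiagonal f g (suc (suc k)) e₀ e = +-cong (e 0 (suc (suc k))) (trans
    (antidiagonal-dropʳ (f ∘ suc) k (λ a → e₀ (suc a) 0 (s≤s z≤n)))
    (antidiagonal⇒halfDiagonal (λ i n → f (suc i) (suc n)) (g ∘ suc) k
      (λ i n n<i → e₀ (suc i) (suc n) (s≤s n<i)) (e ∘ suc)))

  halfDiagonal-+ : ∀ f g k → halfDiagonal (λ i r → f i r + g i r) k ≈
                             halfDiagonal f k + halfDiagonal g k
  halfDiagonal-+ f g zero          = refl
  halfDiagonal-+ f g (suc zero)    = refl
  halfDiagonal-+ f g (suc (suc k)) = trans (+-congˡ (halfDiagonal-+ (f ∘ suc) (g ∘ suc) k))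
    (solve 4 (λ a b c d → (a :+ b) :+ (c :+ d) := (a :+ c) :+ (b :+ d)) refl _ _ _ _)

  -- Along the half-diagonal 2i + r is constantly k, so a weight that depends only on 2i + r factors
  -- out.
  halfDiagonal-weight : ∀ (x : ℕ → Carrier) f k →
    halfDiagonal (λ i r → x (i ℕ.* 2 ℕ.+ r) * f i r) k ≈ x k * halfDiagonal f k
  halfDiagonal-weight x f zero          = refl
  halfDiagonal-weight x f (suc zero)    = refl
  halfDiagonal-weight x f (suc (suc k)) = trans
    (+-congˡ (halfDiagonal-weight (x ∘ suc ∘ suc) (f ∘ suc) k)) (sym (distribˡ _ _ _))

  -- Stands for the index n - 1 with value 0 below the range. It serves both for Θ(k-1) at k = 0 and
  -- for the binomial whose lower index is -1.
  delay : (ℕ → Carrier) → ℕ → Carrier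
  delay f zero    = 0#
  delay f (suc n) = f n

  halfDiagonal-delay : ∀ f k → halfDiagonal (λ i → delay (f i)) k ≈ delay (halfDiagonal f) k
  halfDiagonal-delay f zero                = refl
  halfDiagonal-delay f (suc zero)          = refl
  -- For even k the half-diagonal ends at r = 0, where the delayed family is 0; that last term
  -- disappears here.
  halfDiagonal-delay f (suc (suc zero))    = +-identityʳ _
  halfDiagonal-delay f (suc (suc (suc k))) = +-congˡ (halfDiagonal-delay (f ∘ suc) (suc k))

  private
    halfDiagonal-split : ∀ f g h k →
      (∀ i r → f i (suc r) ≈ g i r + h i (suc r)) → (∀ i → f i 0 ≈ h i 0) →
      halfDiagonal f (suc k) ≈ halfDiagonal g k + halfDiagonal h (suc k)
    halfDiagonal-split f g h zero          e e₀ = e 0 0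
    halfDiagonal-split f g h (suc zero)    e e₀ =
      trans (+-cong (e 0 1) (e₀ 1)) (+-assoc _ _ _)
    halfDiagonal-split f g h (suc (suc k)) e e₀ = trans
      (+-cong (e 0 (suc (suc k)))
        (halfDiagonal-split (f ∘ suc) (g ∘ suc) (h ∘ suc) k (e ∘ suc) (e₀ ∘ suc)))
      (solve 4 (λ a b c d → (a :+ b) :+ (c :+ d) := (a :+ c) :+ (b :+ d)) refl _ _ _ _)

  -- A point with 2i + r = k + 2 has the neighbours (i, r-1), on the half-diagonal k + 1, and (i-1,
  -- r), on the half-diagonal k. On each of the edges i = 0 and r = 0 only one of them exists, hence
  -- three hypotheses.
  halfDiagonal-recurrence : ∀ f g h k →
    (∀ r → f 0 (suc r) ≈ g 0 r) →
    (∀ i r → f (suc i) (suc r) ≈ g (suc i) r + h i (suc r)) →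
    (∀ i → f (suc i) 0 ≈ h i 0) →
    halfDiagonal f (suc (suc k)) ≈ halfDiagonal g (suc k) + halfDiagonal h k
  halfDiagonal-recurrence f g h zero    e₀ e e₁ = +-cong (e₀ 1) (e₁ 0)
  halfDiagonal-recurrence f g h (suc k) e₀ e e₁ = trans
    (+-cong (e₀ (suc (suc k))) (halfDiagonal-split (f ∘ suc) (g ∘ suc) h k e e₁))
    (sym (+-assoc _ _ _))

-- Gaussian binomials and the q-binomial theorem.

module Gaussian (R : CommutativeSemiring 0ℓ 0ℓ) (p : CommutativeSemiring.Carrier R) where
  open CommutativeSemiring R
  open Sums R
  open Exp R
  open SemiringSolver R using (solve; con; _:=_; _:+_; _:*_)
  open SetoidReasoning setoid

  -- gauss a b is the Gaussian binomial coefficient [a+b, a] in base p.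
  gauss : ℕ → ℕ → Carrier
  gauss zero    b       = 1#
  gauss (suc a) zero    = 1#
  gauss (suc a) (suc b) = gauss a (suc b) + p ^ suc a * gauss (suc a) b

  gauss-0ʳ : ∀ a → gauss a 0 ≈ 1#
  gauss-0ʳ zero    = refl
  gauss-0ʳ (suc a) = refl

  -- The Pochhammer symbol (-y; p)_n, written without signs so that it makes sense over a semiring.
  rising : Carrier → ℕ → Carrier
  rising y zero    = 1#
  rising y (suc n) = (1# + y) * rising (y * p) n

  rising-cong : ∀ {y z} n → y ≈ z → rising y n ≈ rising z n
  rising-cong zero    e = refl
  rising-cong (suc n) e = *-cong (+-congˡ e) (rising-cong n (*-congʳ e))

  rising-last : ∀ y n → rising y (suc n) ≈ rising y n * (1# + y * p ^ n)
  rising-last y zero    =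
    solve 1 (λ y → (con 1 :+ y) :* con 1 := con 1 :* (con 1 :+ y :* con 1)) refl y
  rising-last y (suc n) = trans (*-congˡ (rising-last (y * p) n))
    (solve 4 (λ y p r e → (con 1 :+ y) :* (r :* (con 1 :+ y :* p :* e)) :=
                          (con 1 :+ y) :* r :* (con 1 :+ y :* (p :* e))) refl y p _ (p ^ n))

  -- theta y m = y^m p^(m(m-1)/2)
  theta : Carrier → ℕ → Carrier
  theta y zero    = 1#
  theta y (suc m) = y * theta (y * p) m

  theta-cong : ∀ {y z} m → y ≈ z → theta y m ≈ theta z m
  theta-cong zero    e = refl
  theta-cong (suc m) e = *-cong e (theta-cong m (*-congʳ e))

  theta-* : ∀ y m → theta (y * p) m ≈ p ^ m * theta y m
  theta-* y zero    = sym (*-identityˡ 1#)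
  theta-* y (suc m) = trans (*-congˡ (theta-* (y * p) m))
    (solve 4 (λ y p e θ → (y :* p) :* (e :* θ) := (p :* e) :* (y :* θ)) refl y p (p ^ m) _)

  theta-last : ∀ y m → theta y (suc m) ≈ theta y m * (y * p ^ m)
  theta-last y m = trans (*-congˡ (theta-* y m))
    (solve 3 (λ y e θ → y :* (e :* θ) := θ :* (y :* e)) refl y (p ^ m) _)

  -- Pascal's rule and `theta-*` turn the sum at n + 1 for y into the sum at n for yp plus y times
  -- that same sum; this produces the new factor 1 + y.
  q-binomial-theorem : ∀ y n →
    antidiagonal (λ m r → theta y m * gauss m r) n ≈ rising y n
  q-binomial-theorem y zero    = *-identityˡ 1#
  q-binomial-theorem y (suc n) = begin
    1# * 1# + antidiagonal (f ∘ suc) n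
      ≈⟨ step n ⟩
    antidiagonal (λ m r → theta (y * p) m * gauss m r) n +
    antidiagonal (λ m r → y * (theta (y * p) m * gauss m r)) n
      ≈⟨ +-cong (q-binomial-theorem (y * p) n)
           (trans (antidiagonal-* y _ n) (*-congˡ (q-binomial-theorem (y * p) n))) ⟩
    rising (y * p) n + y * rising (y * p) n
      ≈⟨ solve 2 (λ y r → r :+ y :* r := (con 1 :+ y) :* r) refl y _ ⟩
    (1# + y) * rising (y * p) n ∎
    where
    f g h : ℕ → ℕ → Carrier
    f m r = theta y m * gauss m r
    g m r = theta (y * p) m * gauss m r
    h m r = y * (theta (y * p) m * gauss m r)

    pascal : ∀ m r → f (suc m) (suc r) ≈ g (suc m) r + h m (suc r)
    pascal m r = trans
      (solve 5 (λ y θ G e G′ → y :* θ :* (G :+ e :* G′) := e :* (y :* θ) :* G′ :+ y :* (θ :* G))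
        refl y (theta (y * p) m) (gauss m (suc r)) (p ^ suc m) (gauss (suc m) r))
      (+-congʳ (*-congʳ (sym (theta-* y (suc m)))))

    edge : ∀ m → f (suc m) 0 ≈ h m 0
    edge m = trans (*-assoc _ _ _) (*-congˡ (*-congˡ (sym (gauss-0ʳ m))))

    -- The leading `1# * 1#` is the term of `g` at m = 0, since `gauss 0 r` is 1 for every r.
    -- Pascal's rule handles the terms with positive m.
    step : ∀ n → 1# * 1# + antidiagonal (f ∘ suc) n ≈ antidiagonal g n + antidiagonal h n
    step zero    = +-congˡ (edge 0)
    step (suc n) = trans
      (+-congˡ (antidiagonal-split (f ∘ suc) (g ∘ suc) h n pascal edge))
      (sym (+-assoc _ _ _))

-- Factorial formula, symmetry and trinomial revision.

record Pochhammer (D : IntegralDomain) (p : IntegralDomain.Carrier D) : Set where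
  open IntegralDomain D
  open Exp commutativeSemiring using (_^_)
  field
    -- The symbol (p; p)_n, known only through its recursion and its non-vanishing, so that the
    -- argument runs in an arbitrary integral domain.
    F      : ℕ → Carrier
    F-zero : F 0 ≈ 1#
    F-suc  : ∀ n → F (suc n) ≈ F n * (1# - p * p ^ n)
    F≉0    : ∀ n → ¬ F n ≈ 0#

module GaussianFactorial (D : IntegralDomain) (p : IntegralDomain.Carrier D)
                         (pochhammer : Pochhammer D p) where
  open IntegralDomain D
  open Pochhammer pochhammer
  open Sums commutativeSemiring
  open Gaussian commutativeSemiring p
  open Exp commutativeSemiring using (_^_; ^-homo-*)
  open GroupProperties +-group using (∙-cancelʳ)
  open SemiringSolver commutativeSemiring using (solve; con; _:=_; _:+_; _:*_)
  open SetoidReasoning setoid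

  private
    minus-plus : ∀ e → 1# - e + e ≈ 1#
    minus-plus e = trans (+-assoc _ _ _) (trans (+-congˡ (-‿inverseˡ e)) (+-identityʳ 1#))

    1-p^[a+b] : ∀ a b → (1# - p * p ^ a) + p * p ^ a * (1# - p * p ^ b) ≈ 1# - p * p ^ (a ℕ.+ suc b)
    -- Adding p^(a+b+2) to both sides turns the subtractions into pairs (1 - e) + e; the semiring
    -- solver can then treat 1 - e and 1 - f as atoms.
    1-p^[a+b] a b = ∙-cancelʳ (p * p ^ (a ℕ.+ suc b)) _ _ (begin
      (1# - e) + e * (1# - f) + p * p ^ (a ℕ.+ suc b)
        ≈⟨ +-congˡ (trans (*-congˡ (^-homo-* p a (suc b))) (sym (*-assoc p _ _))) ⟩
      (1# - e) + e * (1# - f) + e * f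
        ≈⟨ solve 4 (λ x y e f → x :+ e :* y :+ e :* f := x :+ e :* (y :+ f)) refl (1# - e) (1# - f) e f ⟩
      (1# - e) + e * ((1# - f) + f)
        ≈⟨ +-congˡ (trans (*-congˡ (minus-plus f)) (*-identityʳ e)) ⟩
      (1# - e) + e
        ≈⟨ minus-plus e ⟩
      1#
        ≈⟨ minus-plus _ ⟨
      1# - p * p ^ (a ℕ.+ suc b) + p * p ^ (a ℕ.+ suc b) ∎)
      where e = p * p ^ a
            f = p * p ^ b

  -- After Pascal's rule both induction hypotheses yield the same factor F(a+b+1), and the remaining
  -- factors combine by `1-p^[a+b]`. The product form keeps the formula inside the domain.
  gauss-factorial : ∀ a b → gauss a b * (F a * F b) ≈ F (a ℕ.+ b)
  gauss-factorial zero    b    = trans (*-identityˡ _) (trans (*-congʳ F-zero) (*-identityˡ _))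
  gauss-factorial (suc a) zero = trans (*-identityˡ _) (trans (*-congˡ F-zero)
    (trans (*-identityʳ _) (reflexive (≡.cong F (≡.sym (ℕ.+-identityʳ (suc a)))))))
  gauss-factorial (suc a) (suc b) = begin
    (G + e * G′) * (F (suc a) * F (suc b))
      ≈⟨ solve 5 (λ G e G′ A B → (G :+ e :* G′) :* (A :* B) := G :* (A :* B) :+ e :* (G′ :* (A :* B)))
           refl G e G′ (F (suc a)) (F (suc b)) ⟩
    G * (F (suc a) * F (suc b)) + e * (G′ * (F (suc a) * F (suc b)))
      ≈⟨ +-cong (*-congˡ (*-congʳ (F-suc a))) (*-congˡ (*-congˡ (*-congˡ (F-suc b)))) ⟩
    G * (F a * x * F (suc b)) + e * (G′ * (F (suc a) * (F b * y)))
      ≈⟨ solve 9 (λ G G′ A A′ B B′ x y e →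
           G :* (A :* x :* B′) :+ e :* (G′ :* (A′ :* (B :* y))) :=
           G :* (A :* B′) :* x :+ G′ :* (A′ :* B) :* (e :* y))
           refl G G′ (F a) (F (suc a)) (F b) (F (suc b)) x y e ⟩
    G * (F a * F (suc b)) * x + G′ * (F (suc a) * F b) * (e * y)
      ≈⟨ +-cong (*-congʳ (gauss-factorial a (suc b))) (*-congʳ (trans (gauss-factorial (suc a) b)
           (reflexive (≡.cong F (≡.sym (ℕ.+-suc a b)))))) ⟩
    F (a ℕ.+ suc b) * x + F (a ℕ.+ suc b) * (e * y)
      ≈⟨ distribˡ _ _ _ ⟨
    F (a ℕ.+ suc b) * (x + e * y)
      ≈⟨ *-congˡ (1-p^[a+b] a b) ⟩
    F (a ℕ.+ suc b) * (1# - p * p ^ (a ℕ.+ suc b))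
      ≈⟨ F-suc _ ⟨
    F (suc (a ℕ.+ suc b)) ∎
    where G  = gauss a (suc b)
          G′ = gauss (suc a) b
          e  = p * p ^ a
          x  = 1# - p * p ^ a
          y  = 1# - p * p ^ b

  -- The factorial formula is symmetric in a and b although the recursion for `gauss` is not;
  -- cancelling `F a * F b` transfers the symmetry.
  gauss-comm : ∀ a b → gauss a b ≈ gauss b a
  gauss-comm a b = *-cancelˡ-nonZero (F a * F b) _ _ (*-nonZero (F≉0 a) (F≉0 b)) (begin
    F a * F b * gauss a b     ≈⟨ *-comm _ _ ⟩
    gauss a b * (F a * F b)   ≈⟨ gauss-factorial a b ⟩
    F (a ℕ.+ b)               ≡⟨ ≡.cong F (ℕ.+-comm a b) ⟩
    F (b ℕ.+ a)               ≈⟨ gauss-factorial b a ⟨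
    gauss b a * (F b * F a)   ≈⟨ *-comm _ _ ⟩
    F b * F a * gauss b a     ≈⟨ *-congʳ (*-comm _ _) ⟩
    F a * F b * gauss b a     ∎)

  gauss-pascalʳ : ∀ a b → gauss (suc a) (suc b) ≈ gauss (suc a) b + p ^ suc b * gauss a (suc b)
  gauss-pascalʳ a b = trans (gauss-comm (suc a) (suc b))
    (+-cong (gauss-comm b (suc a)) (*-congˡ (gauss-comm (suc b) a)))

  -- Both sides are the trinomial coefficient F(i+m+r) / (F(i) F(m) F(r)). The factors F(i+r) and
  -- F(m+r) of `d` let the factorial formula apply to all four `gauss` values under one common
  -- multiplier.
  gauss-trinomial : ∀ i m r → gauss i r * gauss m (i ℕ.+ r) ≈ gauss i (m ℕ.+ r) * gauss m r
  gauss-trinomial i m r = *-cancelˡ-nonZero d _ _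
    (*-nonZero (*-nonZero (F≉0 i) (*-nonZero (F≉0 m) (F≉0 r)))
               (*-nonZero (F≉0 (i ℕ.+ r)) (F≉0 (m ℕ.+ r)))) (begin
    d * (gauss i r * gauss m (i ℕ.+ r))
      ≈⟨ solve 7 (λ I M R I′ M′ g h → I :* (M :* R) :* (I′ :* M′) :* (g :* h) :=
                                      g :* (I :* R) :* (h :* (M :* I′)) :* M′)
           refl (F i) (F m) (F r) (F (i ℕ.+ r)) (F (m ℕ.+ r)) (gauss i r) (gauss m (i ℕ.+ r)) ⟩
    gauss i r * (F i * F r) * (gauss m (i ℕ.+ r) * (F m * F (i ℕ.+ r))) * F (m ℕ.+ r)
      ≈⟨ *-congʳ (*-cong (gauss-factorial i r) (gauss-factorial m (i ℕ.+ r))) ⟩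
    F (i ℕ.+ r) * F (m ℕ.+ (i ℕ.+ r)) * F (m ℕ.+ r)
      ≡⟨ ≡.cong (λ n → F (i ℕ.+ r) * F n * F (m ℕ.+ r)) m+[i+r]≡i+[m+r] ⟩
    F (i ℕ.+ r) * F (i ℕ.+ (m ℕ.+ r)) * F (m ℕ.+ r)
      ≈⟨ *-cong (*-congˡ (gauss-factorial i (m ℕ.+ r))) (gauss-factorial m r) ⟨
    F (i ℕ.+ r) * (gauss i (m ℕ.+ r) * (F i * F (m ℕ.+ r))) * (gauss m r * (F m * F r))
      ≈⟨ solve 7 (λ I M R I′ M′ g h → I′ :* (g :* (I :* M′)) :* (h :* (M :* R)) :=
                                      I :* (M :* R) :* (I′ :* M′) :* (g :* h))
           refl (F i) (F m) (F r) (F (i ℕ.+ r)) (F (m ℕ.+ r)) (gauss i (m ℕ.+ r)) (gauss m r) ⟩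
    d * (gauss i (m ℕ.+ r) * gauss m r) ∎)
    where
    d = F i * (F m * F r) * (F (i ℕ.+ r) * F (m ℕ.+ r))
    m+[i+r]≡i+[m+r] : m ℕ.+ (i ℕ.+ r) ≡ i ℕ.+ (m ℕ.+ r)
    m+[i+r]≡i+[m+r] = ≡.trans (≡.sym (ℕ.+-assoc m i r))
      (≡.trans (≡.cong (ℕ._+ r) (ℕ.+-comm m i)) (ℕ.+-assoc i m r))

  -- The sums Θ_w and their recurrence.

  module ThetaSum (τ : Carrier) where
    open Exp commutativeSemiring using (^-assocʳ)

    -- weight w i = τ^i w^i p^(i²)
    weight : Carrier → ℕ → Carrier
    weight w zero    = 1#
    weight w (suc i) = τ * (w * p ^ suc (i ℕ.* 2)) * weight w i

    summand : Carrier → ℕ → ℕ → Carrier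
    summand w i r = weight w i * (gauss i r * rising (w * p ^ i) r)

    thetaSum : Carrier → ℕ → Carrier
    thetaSum w = halfDiagonal (summand w)

    ^-double : ∀ i → p ^ (i ℕ.* 2) ≈ p ^ i * p ^ i
    ^-double i = trans (sym (^-assocʳ p i 2)) (*-congˡ (*-identityʳ _))

    -- Both multipliers depend only on 2i + r, which is k + 1 on one half-diagonal and k on the
    -- other. They can therefore be moved inside the sums, and the identity is checked term by term.
    thetaSum-recurrence : ∀ w k → thetaSum w (suc (suc k)) ≈
      (1# + w * p ^ suc k) * thetaSum w (suc k) + τ * (w * p ^ suc k) * thetaSum w k
    thetaSum-recurrence w k = trans
      (halfDiagonal-recurrence (summand w)
        (λ i r → (1# + w * p ^ (i ℕ.* 2 ℕ.+ r)) * summand w i r)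
        (λ i r → τ * (w * p ^ suc (i ℕ.* 2 ℕ.+ r)) * summand w i r)
        k first interior edge)
      (+-cong (halfDiagonal-weight (λ n → 1# + w * p ^ n) (summand w) (suc k))
              (halfDiagonal-weight (λ n → τ * (w * p ^ suc n)) (summand w) k))
      where
      first : ∀ r → summand w 0 (suc r) ≈ (1# + w * p ^ r) * summand w 0 r
      first r = trans (*-congˡ (*-congˡ (rising-last (w * 1#) r)))
        (solve 3 (λ w e ρ → con 1 :* (con 1 :* (ρ :* (con 1 :+ w :* con 1 :* e))) :=
                            (con 1 :+ w :* e) :* (con 1 :* (con 1 :* ρ)))
          refl w (p ^ r) (rising (w * 1#) r))

      edge : ∀ i → summand w (suc i) 0 ≈ τ * (w * p ^ suc (i ℕ.* 2 ℕ.+ 0)) * summand w i 0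
      edge i = trans (trans (*-congˡ (*-identityʳ 1#)) (*-identityʳ _)) (*-cong
        (reflexive (≡.cong (λ n → τ * (w * p ^ suc n)) (≡.sym (ℕ.+-identityʳ (i ℕ.* 2)))))
        (sym (trans (*-congˡ (trans (*-identityʳ _) (gauss-0ʳ i))) (*-identityʳ _))))

      interior : ∀ i r → summand w (suc i) (suc r) ≈
        (1# + w * p ^ (suc i ℕ.* 2 ℕ.+ r)) * summand w (suc i) r +
        τ * (w * p ^ suc (i ℕ.* 2 ℕ.+ suc r)) * summand w i (suc r)
      interior i r = begin
        τ * (w * (p * EE)) * W * (G * rising y (suc r))
          ≈⟨ *-cong (*-congʳ (*-congˡ (*-congˡ (*-congˡ (^-double i)))))
               (*-congˡ (rising-last y r)) ⟩
        τ * (w * (p * (E * E))) * W * (G * (Q * (1# + y * S)))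
          ≈⟨ solve 8 (λ τ w p E W G Q S →
               τ :* (w :* (p :* (E :* E))) :* W :* (G :* (Q :* (con 1 :+ w :* (p :* E) :* S))) :=
               τ :* (w :* (p :* (E :* E))) :* W :* Q :* (G :+ w :* (p :* E) :* S :* G))
               refl τ w p E W G Q S ⟩
        τ * (w * (p * (E * E))) * W * Q * (G + w * (p * E) * S * G)
          -- The two copies of `G` are expanded differently: the first by `gauss-pascalʳ`, the
          -- second by the definition of `gauss`. Then `h` collects 1 + w p^(2i+r+2), while `g`
          -- collects p^(r+1) (1 + w p^i), which supplies the first factor of
          -- `rising (w * p ^ i) (suc r)`.
          ≈⟨ *-congˡ (+-congʳ (gauss-pascalʳ i r)) ⟩
        τ * (w * (p * (E * E))) * W * Q * (h + p * S * g + w * (p * E) * S * (g + p * E * h))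
          ≈⟨ solve 9 (λ τ w p E W g h Q S →
               τ :* (w :* (p :* (E :* E))) :* W :* Q :*
                 (h :+ p :* S :* g :+ w :* (p :* E) :* S :* (g :+ p :* E :* h)) :=
               (con 1 :+ w :* (p :* (p :* (E :* E :* S)))) :*
                 (τ :* (w :* (p :* (E :* E))) :* W :* (h :* Q)) :+
               τ :* (w :* (p :* (E :* E :* (p :* S)))) :* (W :* (g :* ((con 1 :+ w :* E) :* Q))))
               refl τ w p E W g h Q S ⟩
        (1# + w * (p * (p * (E * E * S)))) * (τ * (w * (p * (E * E))) * W * (h * Q)) +
        τ * (w * (p * (E * E * (p * S)))) * (W * (g * ((1# + w * E) * Q)))
          ≈⟨ +-cong
               (*-cong (+-congˡ (*-congˡ (*-congˡ (*-congˡ (^-split r)))))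
                       (*-congʳ (*-congʳ (*-congˡ (*-congˡ (*-congˡ (^-double i)))))))
               (*-cong (*-congˡ (*-congˡ (*-congˡ (^-split (suc r)))))
                       (*-congˡ (*-congˡ (*-congˡ (rising-cong r
                         (trans (*-assoc w _ p) (*-congˡ (*-comm _ p)))))))) ⟨
        (1# + w * p ^ (suc i ℕ.* 2 ℕ.+ r)) * summand w (suc i) r +
        τ * (w * p ^ suc (i ℕ.* 2 ℕ.+ suc r)) * summand w i (suc r) ∎
        where
        E  = p ^ i
        EE = p ^ (i ℕ.* 2)
        S  = p ^ r
        W  = weight w i
        y  = w * p ^ suc i
        Q  = rising y r
        G  = gauss (suc i) (suc r)
        g  = gauss i (suc r)
        h  = gauss (suc i) r
        ^-split : ∀ n → p ^ (i ℕ.* 2 ℕ.+ n) ≈ E * E * p ^ n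
        ^-split n = trans (^-homo-* p (i ℕ.* 2) n) (*-congʳ (^-double i))

    -- Replacing w by wp and k by k - 1 leaves w p^(k+1) unchanged, so the delayed sum obeys the
    -- recurrence of `thetaSum w`.
    delayed-thetaSum-recurrence : ∀ w k → delay (thetaSum (w * p)) (suc (suc k)) ≈
      (1# + w * p ^ suc k) * delay (thetaSum (w * p)) (suc k) +
      τ * (w * p ^ suc k) * delay (thetaSum (w * p)) k
    -- The default 0 fits the recurrence here because Θ_{wp}(1) = 1 + wp and Θ_{wp}(0) = 1.
    delayed-thetaSum-recurrence w zero =
      solve 3 (λ w p τ → con 1 :* (con 1 :* ((con 1 :+ w :* p :* con 1) :* con 1)) :=
        (con 1 :+ w :* (p :* con 1)) :* (con 1 :* (con 1 :* con 1)) :+ τ :* (w :* (p :* con 1)) :* con 0)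
        refl w p τ
    delayed-thetaSum-recurrence w (suc k) = trans (thetaSum-recurrence (w * p) k)
      (+-cong (*-congʳ (+-congˡ (*-assoc w p _))) (*-congʳ (*-congˡ (*-assoc w p _))))

    -- Evaluation of the double sum.

    binomial : ℕ → ℕ → Carrier
    binomial n i = if i ℕ.≤ᵇ n then gauss i (n ∸ i) else 0#

    binomial-≥ : ∀ i r → binomial (i ℕ.+ r) i ≡ gauss i r
    binomial-≥ i r rewrite Equivalence.to T-≡ (ℕ.≤⇒≤ᵇ (ℕ.m≤m+n i r)) = ≡.cong (gauss i) (ℕ.m+n∸m≡n i r)

    binomial-< : ∀ {i n} → n ℕ.< i → binomial n i ≡ 0#
    binomial-< {i} {n} n<i with i ℕ.≤ᵇ n in eq
    ... | false = ≡.refl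
    ... | true  = contradiction (ℕ.≤ᵇ⇒≤ i n (Equivalence.from T-≡ eq)) (ℕ.<⇒≱ n<i)

    weight-* : ∀ w i → weight (w * p) i ≈ weight w i * p ^ i
    weight-* w zero    = sym (*-identityˡ 1#)
    weight-* w (suc i) = trans (*-congˡ (weight-* w i))
      (solve 6 (λ τ w p e W E → τ :* (w :* p :* e) :* (W :* E) := τ :* (w :* e) :* W :* (p :* E))
        refl τ w p (p ^ suc (i ℕ.* 2)) (weight w i) (p ^ i))

    module _ (w t : Carrier) where

      -- The term of the theorem at j = i + m and k = j + s. For w = -q and τ = -t² the product of
      -- `weight` and `theta` is the sign with the powers of t and q, by `weight-theta`.
      doubleSummand : ℕ → ℕ → ℕ → Carrier
      doubleSummand i m s = weight w i * theta (w * p ^ i) m * binomial s i *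
        (gauss m s + t * delay (λ m → gauss m s) m)

      private
        -- Named for their parity in t once τ = -t². The index s has been replaced by i + s, below
        -- which [s, i] vanishes.
        even odd : ℕ → ℕ → ℕ → Carrier
        even i m s = weight w i * (theta (w * p ^ i) m * (gauss i s * gauss m (i ℕ.+ s)))
        odd  i m s = t * (weight w i * (theta (w * p ^ i) m *
                       (gauss i s * delay (λ m → gauss m (i ℕ.+ s)) m)))

        trinomial : ∀ {r} i m s → m ℕ.+ s ≡ r → gauss i s * gauss m (i ℕ.+ s) ≈ gauss i r * gauss m s
        trinomial i m s ≡.refl = gauss-trinomial i m s

        -- Trinomial revision replaces the two binomials by [i+r, i], which is constant in m, and
        -- [m+s, m]; what is left is the q-binomial theorem.
        even-sum : ∀ i r → antidiagonal (even i) r ≈ summand w i r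
        even-sum i r = begin
          antidiagonal (even i) r
            ≈⟨ antidiagonal-cong r (λ m s m+s≡r → trans
                 (*-congˡ (*-congˡ (trinomial i m s m+s≡r)))
                 (solve 4 (λ W θ G g → W :* (θ :* (G :* g)) := W :* G :* (θ :* g))
                   refl (weight w i) (theta (w * p ^ i) m) (gauss i r) (gauss m s))) ⟩
          antidiagonal (λ m s → weight w i * gauss i r * (theta (w * p ^ i) m * gauss m s)) r
            ≈⟨ antidiagonal-* _ _ r ⟩
          weight w i * gauss i r * antidiagonal (λ m s → theta (w * p ^ i) m * gauss m s) r
            ≈⟨ *-congˡ (q-binomial-theorem _ r) ⟩
          weight w i * gauss i r * rising (w * p ^ i) r
            ≈⟨ *-assoc _ _ _ ⟩
          summand w i r ∎

        odd-zero : ∀ i s → odd i 0 s ≈ 0#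
        odd-zero i s = solve 4 (λ t W θ G → t :* (W :* (θ :* (G :* con 0))) := con 0)
          refl t (weight w i) 1# (gauss i s)

        -- The first factor w p^i of `theta` is split: w goes to the front, and p^i changes
        -- `weight w i` into `weight (w * p) i`. Thus the odd part is the even one with w replaced
        -- by wp and r lowered by one.
        odd-suc : ∀ {r} i m s → m ℕ.+ s ≡ r → odd i (suc m) s ≈
          t * w * weight (w * p) i * gauss i r * (theta (w * p * p ^ i) m * gauss m s)
        odd-suc {r} i m s m+s≡r = begin
          t * (W * (w * E * θ * (gauss i s * gauss m (i ℕ.+ s))))
            ≈⟨ *-congˡ (*-congˡ (*-congˡ (trinomial i m s m+s≡r))) ⟩
          t * (W * (w * E * θ * (gauss i r * gauss m s)))
            ≈⟨ solve 7 (λ t W w E θ G g → t :* (W :* (w :* E :* θ :* (G :* g))) :=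
                                          t :* w :* (W :* E) :* G :* (θ :* g))
                 refl t W w E θ (gauss i r) (gauss m s) ⟩
          t * w * (W * E) * gauss i r * (θ * gauss m s)
            ≈⟨ *-cong (*-congʳ (*-congˡ (sym (weight-* w i))))
                 (*-congʳ (theta-cong m (solve 3 (λ w E p → w :* E :* p := w :* p :* E) refl w E p))) ⟩
          t * w * weight (w * p) i * gauss i r * (theta (w * p * p ^ i) m * gauss m s) ∎
          where W = weight w i
                E = p ^ i
                θ = theta (w * p ^ i * p) m

        odd-sum : ∀ i r → antidiagonal (odd i) r ≈ t * w * delay (summand (w * p) i) r
        odd-sum i zero    = trans (odd-zero i 0) (sym (zeroʳ _))
        odd-sum i (suc r) = begin
          odd i 0 (suc r) + antidiagonal (odd i ∘ suc) r
            ≈⟨ trans (+-congʳ (odd-zero i (suc r))) (+-identityˡ _) ⟩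
          antidiagonal (odd i ∘ suc) r
            ≈⟨ antidiagonal-cong r (odd-suc i) ⟩
          antidiagonal (λ m s → t * w * weight (w * p) i * gauss i r *
                                (theta (w * p * p ^ i) m * gauss m s)) r
            ≈⟨ antidiagonal-* _ _ r ⟩
          t * w * weight (w * p) i * gauss i r *
            antidiagonal (λ m s → theta (w * p * p ^ i) m * gauss m s) r
            ≈⟨ *-congˡ (q-binomial-theorem _ r) ⟩
          t * w * weight (w * p) i * gauss i r * rising (w * p * p ^ i) r
            ≈⟨ trans (*-assoc _ _ _) (*-assoc _ _ _) ⟩
          t * w * summand (w * p) i r ∎

        vanish : ∀ i m s → s ℕ.< i → doubleSummand i m s ≈ 0#
        vanish i m s s<i = trans
          (*-congʳ (trans (*-congˡ (reflexive (binomial-< s<i))) (zeroʳ _))) (zeroˡ _)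

        diagonal : ∀ i r → antidiagonal (doubleSummand i) (i ℕ.+ r) ≈
                   summand w i r + t * w * delay (summand (w * p) i) r
        diagonal i r = begin
          antidiagonal (doubleSummand i) (i ℕ.+ r)
            ≈⟨ antidiagonal-shiftʳ i (doubleSummand i) r (vanish i) ⟩
          antidiagonal (λ m s → doubleSummand i m (i ℕ.+ s)) r
            ≈⟨ antidiagonal-cong r (λ m s _ → trans
                 (*-congʳ (*-congˡ (reflexive (binomial-≥ i s))))
                 (solve 6 (λ W θ G g t g′ → W :* θ :* G :* (g :+ t :* g′) :=
                             W :* (θ :* (G :* g)) :+ t :* (W :* (θ :* (G :* g′))))
                   refl (weight w i) (theta (w * p ^ i) m) (gauss i s) (gauss m (i ℕ.+ s)) t
                   (delay (λ m → gauss m (i ℕ.+ s)) m))) ⟩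
          antidiagonal (λ m s → even i m s + odd i m s) r
            ≈⟨ antidiagonal-+ (even i) (odd i) r ⟩
          antidiagonal (even i) r + antidiagonal (odd i) r
            ≈⟨ +-cong (even-sum i r) (odd-sum i r) ⟩
          summand w i r + t * w * delay (summand (w * p) i) r ∎

      doubleSum : ∀ k →
        antidiagonal (λ j s → antidiagonal (λ i m → doubleSummand i m s) j) k ≈
        thetaSum w k + t * w * delay (thetaSum (w * p)) k
      doubleSum k = begin
        antidiagonal (λ j s → antidiagonal (λ i m → doubleSummand i m s) j) k
          ≈⟨ antidiagonal-assoc doubleSummand k ⟩
        antidiagonal (λ i n → antidiagonal (doubleSummand i) n) k
          -- If m + s = n < i then s < i, so every term of the inner sum vanishes; otherwise n = i +
          -- r and `diagonal` evaluates it.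
          ≈⟨ antidiagonal⇒halfDiagonal _ _ k
               (λ i n n<i → antidiagonal-zero n (λ m s m+s≡n → vanish i m s
                 (ℕ.≤-<-trans (ℕ.≤-trans (ℕ.m≤n+m s m) (ℕ.≤-reflexive m+s≡n)) n<i)))
               diagonal ⟩
        halfDiagonal (λ i r → summand w i r + t * w * delay (summand (w * p) i) r) k
          ≈⟨ halfDiagonal-+ _ _ k ⟩
        thetaSum w k + halfDiagonal (λ i r → t * w * delay (summand (w * p) i) r) k
          ≈⟨ +-congˡ (halfDiagonal-weight (λ _ → t * w) _ k) ⟩
        thetaSum w k + t * w * halfDiagonal (λ i → delay (summand (w * p) i)) k
          ≈⟨ +-congˡ (*-congˡ (halfDiagonal-delay _ k)) ⟩
        thetaSum w k + t * w * delay (thetaSum (w * p)) k ∎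

-- The three-term recurrence for T.

record Recursion (D : IntegralDomain) (t q : IntegralDomain.Carrier D) : Set where
  open IntegralDomain D
  open Exp commutativeSemiring using (_^_)
  field
    T            : ℕ → Carrier
    tailSum      : ℕ → ℕ → Carrier
    T-zero       : T 0 ≈ 1#
    T-suc        : ∀ k → T (suc k) ≈ T k + (1# + t) * (- q) ^ (suc k ℕ.^ 2)
                                         + (1# - t ^ 2) * tailSum (suc k) k
    tailSum-zero : ∀ k → tailSum k 0 ≈ 0#
    tailSum-suc  : ∀ k m → tailSum k (suc m) ≈
                           tailSum k m + (- q) ^ (k ℕ.^ 2 ∸ suc m ℕ.^ 2) * T m

module RecursionSolution (D : IntegralDomain) (t q : IntegralDomain.Carrier D)
  (pochhammer : Pochhammer D (Exp._^_ (IntegralDomain.commutativeSemiring D) q 2))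
  (recursion : Recursion D t q) where
  open IntegralDomain D
  open Recursion recursion
  open Exp commutativeSemiring using (_^_; ^-homo-*; ^-assocʳ; ^-congˡ)
  open Sums commutativeSemiring
  open Gaussian commutativeSemiring (q ^ 2)
  open GaussianFactorial D (q ^ 2) pochhammer
  open ThetaSum (- (t ^ 2))
  open RingProperties ring using (-1*x≈-x; -‿distribˡ-*; -‿distribʳ-*; -‿involutive)
  open SemiringSolver commutativeSemiring using (solve; con; _:=_; _:+_; _:*_)
  open SetoidReasoning setoid

  private
    x p τ : Carrier
    x = - q
    p = q ^ 2
    τ = - (t ^ 2)

    -- The exponent 2k + 3 is (k+2)² - (k+1)², the change in every power of x when k + 1 becomes k +
    -- 2.
    X : ℕ → Carrier
    X k = x ^ suc (2 ℕ.* suc k)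

    X≈ : ∀ k → X k ≈ x * p ^ suc k
    X≈ k = *-congˡ (trans (sym (^-assocʳ x 2 (suc k))) (^-congˡ (suc k)
      (trans (*-congˡ (*-identityʳ x)) (trans x*x≈q*q (*-congˡ (sym (*-identityʳ q)))))))
      where
      x*x≈q*q : x * x ≈ q * q
      x*x≈q*q = trans (sym (-‿distribˡ-* q x))
        (trans (-‿cong (sym (-‿distribʳ-* q q))) (-‿involutive (q * q)))

    -- The bound on m keeps the truncated subtraction on the right exact.
    square-∸ : ∀ k m → m ℕ.≤ suc k →
      suc (suc k) ℕ.^ 2 ∸ m ℕ.^ 2 ≡ suc (2 ℕ.* suc k) ℕ.+ (suc k ℕ.^ 2 ∸ m ℕ.^ 2)
    square-∸ k m m≤1+k = ≡.trans
      (≡.cong (_∸ m ℕ.^ 2) (ℕ-solve 1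
        (λ k → (κ 2 ⊞ k) ⊡ 2 ⊜ κ 1 ⊞ κ 2 ⊠ (κ 1 ⊞ k) ⊞ (κ 1 ⊞ k) ⊡ 2) ≡.refl k))
      (ℕ.+-∸-assoc (suc (2 ℕ.* suc k)) (ℕ.^-monoˡ-≤ 2 m≤1+k))

    tailSum-scale : ∀ k m → m ℕ.≤ k → tailSum (suc (suc k)) m ≈ X k * tailSum (suc k) m
    tailSum-scale k zero    _   =
      trans (tailSum-zero _) (sym (trans (*-congˡ (tailSum-zero _)) (zeroʳ _)))
    tailSum-scale k (suc m) m<k = begin
      tailSum (suc (suc k)) (suc m)
        ≈⟨ tailSum-suc _ m ⟩
      tailSum (suc (suc k)) m + x ^ (suc (suc k) ℕ.^ 2 ∸ suc m ℕ.^ 2) * T m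
        ≡⟨ ≡.cong (λ e → tailSum (suc (suc k)) m + x ^ e * T m) (square-∸ k (suc m) (ℕ.m≤n⇒m≤1+n m<k)) ⟩
      tailSum (suc (suc k)) m + x ^ (suc (2 ℕ.* suc k) ℕ.+ (suc k ℕ.^ 2 ∸ suc m ℕ.^ 2)) * T m
        ≈⟨ +-cong (tailSum-scale k m (ℕ.<⇒≤ m<k)) (*-congʳ (^-homo-* x (suc (2 ℕ.* suc k)) _)) ⟩
      X k * tailSum (suc k) m + X k * x ^ (suc k ℕ.^ 2 ∸ suc m ℕ.^ 2) * T m
        ≈⟨ trans (+-congˡ (*-assoc _ _ _)) (sym (distribˡ _ _ _)) ⟩
      X k * (tailSum (suc k) m + x ^ (suc k ℕ.^ 2 ∸ suc m ℕ.^ 2) * T m)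
        ≈⟨ *-congˡ (tailSum-suc _ m) ⟨
      X k * tailSum (suc k) (suc m) ∎

    -- The longer tail has one additional term, at i = k + 1, whose power of x is exactly `X k`; the
    -- others scale by `X k`.
    tailSum-last : ∀ k → tailSum (suc (suc k)) (suc k) ≈ X k * (tailSum (suc k) k + T k)
    tailSum-last k = begin
      tailSum (suc (suc k)) (suc k)
        ≈⟨ tailSum-suc _ k ⟩
      tailSum (suc (suc k)) k + x ^ (suc (suc k) ℕ.^ 2 ∸ suc k ℕ.^ 2) * T k
        ≡⟨ ≡.cong (λ e → tailSum (suc (suc k)) k + x ^ e * T k) (≡.trans (square-∸ k (suc k) ℕ.≤-refl)
             (≡.trans (≡.cong (suc (2 ℕ.* suc k) ℕ.+_) (ℕ.n∸n≡0 (suc k ℕ.^ 2))) (ℕ.+-identityʳ _))) ⟩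
      tailSum (suc (suc k)) k + X k * T k
        ≈⟨ trans (+-congʳ (tailSum-scale k k ℕ.≤-refl)) (sym (distribˡ _ _ _)) ⟩
      X k * (tailSum (suc k) k + T k) ∎

    T-recurrence : ∀ k → T (suc (suc k)) ≈
      (1# + x * p ^ suc k) * T (suc k) + τ * (x * p ^ suc k) * T k
    T-recurrence k = begin
      T (suc (suc k))
        ≈⟨ T-suc (suc k) ⟩
      T (suc k) + (1# + t) * x ^ (suc (suc k) ℕ.^ 2) + (1# + τ) * tailSum (suc (suc k)) (suc k)
        ≈⟨ +-cong (+-congˡ (*-congˡ (trans
             (reflexive (≡.cong (x ^_) (square-∸ k 0 z≤n)))
             (^-homo-* x (suc (2 ℕ.* suc k)) _)))) (*-congˡ (tailSum-last k)) ⟩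
      T (suc k) + (1# + t) * (X k * Z) + (1# + τ) * (X k * (Y + T k))
        -- Of the 1 + τ copies of X T_k, the single one completes the bracket to the defining
        -- expression for T_{k+1}; the τ copies form the last term of the recurrence.
        ≈⟨ solve 7 (λ T₁ T₀ t X Z τ Y →
             T₁ :+ (con 1 :+ t) :* (X :* Z) :+ (con 1 :+ τ) :* (X :* (Y :+ T₀)) :=
             T₁ :+ X :* (T₀ :+ (con 1 :+ t) :* Z :+ (con 1 :+ τ) :* Y) :+ τ :* X :* T₀)
             refl (T (suc k)) (T k) t (X k) Z τ Y ⟩
      T (suc k) + X k * (T k + (1# + t) * Z + (1# + τ) * Y) + τ * X k * T k
        ≈⟨ +-congʳ (+-congˡ (*-congˡ (T-suc k))) ⟨
      T (suc k) + X k * T (suc k) + τ * X k * T k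
        ≈⟨ +-cong (solve 2 (λ T₁ X → T₁ :+ X :* T₁ := (con 1 :+ X) :* T₁) refl (T (suc k)) (X k)) refl ⟩
      (1# + X k) * T (suc k) + τ * X k * T k
        ≈⟨ +-cong (*-congʳ (+-congˡ (X≈ k))) (*-congʳ (*-congˡ (X≈ k))) ⟩
      (1# + x * p ^ suc k) * T (suc k) + τ * (x * p ^ suc k) * T k ∎
      where Z = x ^ (suc k ℕ.^ 2)
            Y = tailSum (suc k) k

    P : ℕ → Carrier
    P k = thetaSum x k + t * x * delay (thetaSum (x * p)) k

    P-recurrence : ∀ k → P (suc (suc k)) ≈
      (1# + x * p ^ suc k) * P (suc k) + τ * (x * p ^ suc k) * P k
    P-recurrence k = trans
      (+-cong (thetaSum-recurrence x k) (*-congˡ (delayed-thetaSum-recurrence x k)))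
      (solve 7 (λ A B a₁ a₀ c b₁ b₀ →
        A :* a₁ :+ B :* a₀ :+ c :* (A :* b₁ :+ B :* b₀) :=
        A :* (a₁ :+ c :* b₁) :+ B :* (a₀ :+ c :* b₀)) refl
        (1# + x * p ^ suc k) (τ * (x * p ^ suc k)) (thetaSum x (suc k)) (thetaSum x k)
        (t * x) (delay (thetaSum (x * p)) (suc k)) (delay (thetaSum (x * p)) k))

    -- The common recurrence has order two, so the values at 0 and 1 decide; at 1 both sides are 1 +
    -- x + tx.
    T≈P : ∀ k → T k ≈ P k
    T≈P zero = trans T-zero
      (solve 2 (λ t x → con 1 := con 1 :* (con 1 :* con 1) :+ t :* x :* con 0) refl t x)
    T≈P (suc zero) = begin
      T 1
        ≈⟨ T-suc 0 ⟩
      T 0 + (1# + t) * (x * 1#) + (1# + τ) * tailSum 1 0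
        ≈⟨ +-cong (+-congʳ T-zero) (*-congˡ (tailSum-zero 1)) ⟩
      1# + (1# + t) * (x * 1#) + (1# + τ) * 0#
        ≈⟨ solve 3 (λ t x τ →
             con 1 :+ (con 1 :+ t) :* (x :* con 1) :+ (con 1 :+ τ) :* con 0 :=
             con 1 :* (con 1 :* ((con 1 :+ x :* con 1) :* con 1)) :+
             t :* x :* (con 1 :* (con 1 :* con 1))) refl t x τ ⟩
      P 1 ∎
    T≈P (suc (suc k)) = trans (T-recurrence k) (trans
      (+-cong (*-congˡ (T≈P (suc k))) (*-congˡ (T≈P k)))
      (sym (P-recurrence k)))

  -- Signs and powers in the double sum.

  coefficient : ℕ → ℕ → Carrier
  coefficient j i = (- 1#) ^ (j ℕ.+ i) * t ^ (2 ℕ.* i) * q ^ (j ℕ.^ 2 ℕ.+ i ℕ.^ 2 ℕ.+ i)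

  private
    -- Raising j = i + m by one changes the sign and adds 2j + 1 to the exponent of q: the sign and
    -- one q make x, the rest makes p^i p^m.
    coefficient-suc-m : ∀ i m →
      coefficient (i ℕ.+ suc m) i ≈ coefficient (i ℕ.+ m) i * (x * p ^ i * p ^ m)
    coefficient-suc-m i m = begin
      s ^ (i ℕ.+ suc m ℕ.+ i) * A * q ^ ((i ℕ.+ suc m) ℕ.^ 2 ℕ.+ i ℕ.^ 2 ℕ.+ i)
        ≡⟨ ≡.cong₂ (λ a b → s ^ a * A * q ^ b) (≡.cong (ℕ._+ i) (ℕ.+-suc i m)) exponent ⟩
      s * S * A * q ^ (e ℕ.+ suc (2 ℕ.* (i ℕ.+ m)))
        ≈⟨ *-congˡ (trans (^-homo-* q e _) (*-congˡ (*-congˡ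
             (trans (sym (^-assocʳ q 2 (i ℕ.+ m))) (^-homo-* p i m))))) ⟩
      s * S * A * (q ^ e * (q * (p ^ i * p ^ m)))
        ≈⟨ solve 7 (λ s S A Q q I M → s :* S :* A :* (Q :* (q :* (I :* M))) :=
                                      S :* A :* Q :* (s :* q :* I :* M))
             refl s S A (q ^ e) q (p ^ i) (p ^ m) ⟩
      S * A * q ^ e * (s * q * p ^ i * p ^ m)
        ≈⟨ *-congˡ (*-congʳ (*-congʳ (-1*x≈-x q))) ⟩
      S * A * q ^ e * (x * p ^ i * p ^ m) ∎
      where
      s = - 1#
      S = s ^ (i ℕ.+ m ℕ.+ i)
      A = t ^ (2 ℕ.* i)
      e = (i ℕ.+ m) ℕ.^ 2 ℕ.+ i ℕ.^ 2 ℕ.+ i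
      exponent : (i ℕ.+ suc m) ℕ.^ 2 ℕ.+ i ℕ.^ 2 ℕ.+ i ≡ e ℕ.+ suc (2 ℕ.* (i ℕ.+ m))
      exponent = ℕ-solve 2 (λ i m → (i ⊞ (κ 1 ⊞ m)) ⊡ 2 ⊞ i ⊡ 2 ⊞ i ⊜
        (i ⊞ m) ⊡ 2 ⊞ i ⊡ 2 ⊞ i ⊞ (κ 1 ⊞ κ 2 ⊠ (i ⊞ m))) ≡.refl i m

    coefficient-suc-i : ∀ i → coefficient (suc i ℕ.+ 0) (suc i) ≈
      τ * (x * p ^ suc (i ℕ.* 2)) * coefficient (i ℕ.+ 0) i
    coefficient-suc-i i = begin
      s ^ (suc i ℕ.+ 0 ℕ.+ suc i) * t ^ (2 ℕ.* suc i) *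
        q ^ ((suc i ℕ.+ 0) ℕ.^ 2 ℕ.+ suc i ℕ.^ 2 ℕ.+ suc i)
        ≡⟨ ≡.cong₂ (λ a b → s ^ suc a * t ^ (2 ℕ.* suc i) * q ^ b) (ℕ.+-suc (i ℕ.+ 0) i) exponent ⟩
      s * (s * S) * t ^ (2 ℕ.* suc i) * q ^ (e ℕ.+ suc (2 ℕ.* suc (i ℕ.* 2)))
        ≈⟨ *-cong (*-congˡ (trans (sym (^-assocʳ t 2 (suc i))) (*-congˡ (^-assocʳ t 2 i))))
             (trans (^-homo-* q e _) (*-congˡ (*-congˡ (sym (^-assocʳ q 2 (suc (i ℕ.* 2))))))) ⟩
      s * (s * S) * (t ^ 2 * A) * (q ^ e * (q * p ^ suc (i ℕ.* 2)))
        -- Raising i and j together gives two signs: one turns t² into τ, the other turns q into x.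
        ≈⟨ solve 7 (λ s S t² A Q q I → s :* (s :* S) :* (t² :* A) :* (Q :* (q :* I)) :=
                                       s :* t² :* (s :* q :* I) :* (S :* A :* Q))
             refl s S (t ^ 2) A (q ^ e) q (p ^ suc (i ℕ.* 2)) ⟩
      s * t ^ 2 * (s * q * p ^ suc (i ℕ.* 2)) * (S * A * q ^ e)
        ≈⟨ *-congʳ (*-cong (-1*x≈-x (t ^ 2)) (*-congʳ (-1*x≈-x q))) ⟩
      τ * (x * p ^ suc (i ℕ.* 2)) * (S * A * q ^ e) ∎
      where
      s = - 1#
      S = s ^ (i ℕ.+ 0 ℕ.+ i)
      A = t ^ (2 ℕ.* i)
      e = (i ℕ.+ 0) ℕ.^ 2 ℕ.+ i ℕ.^ 2 ℕ.+ i
      exponent : (suc i ℕ.+ 0) ℕ.^ 2 ℕ.+ suc i ℕ.^ 2 ℕ.+ suc i ≡ e ℕ.+ suc (2 ℕ.* suc (i ℕ.* 2))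
      exponent = ℕ-solve 1 (λ i → (κ 1 ⊞ i ⊞ κ 0) ⊡ 2 ⊞ (κ 1 ⊞ i) ⊡ 2 ⊞ (κ 1 ⊞ i) ⊜
        (i ⊞ κ 0) ⊡ 2 ⊞ i ⊡ 2 ⊞ i ⊞ (κ 1 ⊞ κ 2 ⊠ (κ 1 ⊞ i ⊠ κ 2))) ≡.refl i

    -- Induction on m, with induction on i at m = 0; both sides change by the same factor in either
    -- direction.
    weight-theta : ∀ i m → weight x i * theta (x * p ^ i) m ≈ coefficient (i ℕ.+ m) i
    weight-theta zero    zero    =
      solve 0 (con 1 :* con 1 := con 1 :* con 1 :* con 1) refl
    weight-theta (suc i) zero    = begin
      τ * (x * p ^ suc (i ℕ.* 2)) * weight x i * 1#
        ≈⟨ *-assoc _ _ _ ⟩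
      τ * (x * p ^ suc (i ℕ.* 2)) * (weight x i * 1#)
        ≈⟨ *-congˡ (weight-theta i 0) ⟩
      τ * (x * p ^ suc (i ℕ.* 2)) * coefficient (i ℕ.+ 0) i
        ≈⟨ coefficient-suc-i i ⟨
      coefficient (suc i ℕ.+ 0) (suc i) ∎
    weight-theta i       (suc m) = begin
      weight x i * theta (x * p ^ i) (suc m)
        ≈⟨ trans (*-congˡ (theta-last (x * p ^ i) m)) (sym (*-assoc _ _ _)) ⟩
      weight x i * theta (x * p ^ i) m * (x * p ^ i * p ^ m)
        ≈⟨ *-congʳ (weight-theta i m) ⟩
      coefficient (i ℕ.+ m) i * (x * p ^ i * p ^ m)
        ≈⟨ coefficient-suc-m i m ⟨
      coefficient (i ℕ.+ suc m) i ∎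

  T≈doubleSum : ∀ k → T k ≈ antidiagonal (λ j s → antidiagonal (λ i m →
    coefficient j i * binomial s i * (gauss m s + t * delay (λ m → gauss m s) m)) j) k
  T≈doubleSum k = trans (T≈P k) (trans (sym (doubleSum x t k))
    (antidiagonal-cong k λ j s _ → antidiagonal-cong j λ i m i+m≡j →
      *-congʳ (*-congʳ (trans (weight-theta i m)
        (reflexive (≡.cong (λ j → coefficient j i) i+m≡j))))))

-- Fractions that represent elements of the domain.

module Representation (D : IntegralDomain) where
  open IntegralDomain D
  open FieldOfFractions D
  open Sums commutativeSemiring
  open Exp commutativeSemiring using (_^_)
  open RingProperties ring using (-‿distribˡ-*)
  open SemiringSolver commutativeSemiring using (solve; _:=_; _:+_; _:*_)

  private
    module Q where
      open RawRing fractionRing public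
      open RawSemiringDefinitions rawSemiring public

  -- Relating fractions only to elements of D avoids transitivity of equality of fractions.
  infix 4 _represents_
  record _represents_ (x : Fraction) (a : Carrier) : Set where
    constructor represented
    field num≈ : num x ≈ a * den x
  open _represents_ public

  fromDomain-represents : ∀ a → fromDomain a represents a
  fromDomain-represents a = represented (sym (*-identityʳ a))

  represents-cong : ∀ {x a b} → a ≈ b → x represents a → x represents b
  represents-cong a≈b (represented e) = represented (trans e (*-congʳ a≈b))

  represents⇒≈ : ∀ {x a} → x represents a → fromDomain a Q.≈ x
  represents⇒≈ (represented e) = trans (sym e) (sym (*-identityʳ _))

  +-represents : ∀ {x y a b} → x represents a → y represents b → (x Q.+ y) represents (a + b)
  +-represents (represented e) (represented f) = represented (trans
    (+-cong (*-congʳ e) (*-congʳ f))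
    (solve 4 (λ a b d₁ d₂ → a :* d₁ :* d₂ :+ b :* d₂ :* d₁ := (a :+ b) :* (d₁ :* d₂)) refl _ _ _ _))

  *-represents : ∀ {x y a b} → x represents a → y represents b → (x Q.* y) represents (a * b)
  *-represents (represented e) (represented f) = represented (trans (*-cong e f)
    (solve 4 (λ a b d₁ d₂ → a :* d₁ :* (b :* d₂) := a :* b :* (d₁ :* d₂)) refl _ _ _ _))

  -‿represents : ∀ {x a} → x represents a → (Q.- x) represents (- a)
  -‿represents (represented e) = represented (trans (-‿cong e) (-‿distribˡ-* _ _))

  ^-represents : ∀ {x a} n → x represents a → (x Q.^ n) represents (a ^ n)
  ^-represents ℕ.zero r = fromDomain-represents 1#
  ^-represents (suc n) r = *-represents r (^-represents n r)

  -- The positive branch receives the outcome of the test, because the factorial quotient is a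
  -- Gaussian binomial only for m ≤ n.
  if-represents : ∀ b {x y a c} → (b ≡ true → x represents a) → y represents c →
                  (if b then x else y) represents (if b then a else c)
  if-represents false r s = s
  if-represents true  r s = r ≡.refl

  -- The antidiagonal supplies the complement b = n - a together with its equation, which lets the
  -- differences in the theorem be read as natural numbers.
  ∑-represents : ∀ n (f : ℕ → Fraction) (g : ℕ → ℕ → Carrier) →
    (∀ a b → a ℕ.+ b ≡ n → f a represents g a b) →
    Q.sum {suc n} (λ a → f (toℕ a)) represents antidiagonal g n
  ∑-represents ℕ.zero f g r = represents-cong (+-identityʳ _)
    (+-represents (r 0 0 ≡.refl) (fromDomain-represents 0#))
  ∑-represents (suc n) f g r = +-represents (r 0 (suc n) ≡.refl)
    (∑-represents n (f ∘ suc) (g ∘ suc) (λ a b → r (suc a) b ∘ ≡.cong suc))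

-- Specialisation to ℤ[t,q] and integer indices.

private
  module P = Polynomials
  open Representation ℤ[t,q]

  pochhammer : Pochhammer ℤ[t,q] (P.q P.^ 2)
  pochhammer = record
    { F      = P.⟨ P.q P.^ 2 ⨾ P.q P.^ 2 ⟩_
    ; F-zero = P.refl
    ; F-suc  = λ _ → P.refl
    ; F≉0    = P.⟨q²⨾q²⟩≉0
    }

  recursion : Recursion ℤ[t,q] P.t P.q
  recursion = record
    { T            = P.T
    ; tailSum      = P.tailSum
    ; T-zero       = P.refl
    ; T-suc        = λ _ → P.refl
    ; tailSum-zero = λ _ → P.refl
    ; tailSum-suc  = λ _ _ → P.refl
    }

  open Pochhammer pochhammer using (F)
  open RecursionSolution ℤ[t,q] P.t P.q pochhammer recursion
  open Sums P.commutativeSemiring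
  open Gaussian P.commutativeSemiring (P.q P.^ 2)
  open GaussianFactorial ℤ[t,q] (P.q P.^ 2) pochhammer
  open ThetaSum (P.- (P.t P.^ 2))

open import Defs

private
  -- Both definitions branch on the same test; in the positive branch the claim is the factorial
  -- formula.
  binomial-represents : ∀ n m → [ ℤ.+ n , ℤ.+ m ]q² represents binomial n m
  binomial-represents n m = if-represents (m ℕ.≤ᵇ n)
    (λ m≤ᵇn → represented (P.sym (P.trans (gauss-factorial m (n ∸ m))
      (P.reflexive (≡.cong F (ℕ.m+[n∸m]≡n (ℕ.≤ᵇ⇒≤ m n (Equivalence.from T-≡ m≤ᵇn))))))))
    (fromDomain-represents P.0#)

  gauss-represents : ∀ m s → [ ℤ.+ (m ℕ.+ s) , ℤ.+ m ]q² represents gauss m s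
  gauss-represents m s = represents-cong (P.reflexive (binomial-≥ m s)) (binomial-represents (m ℕ.+ s) m)

  [m+n]-m : ∀ m n → ℤ.+ (m ℕ.+ n) ℤ.- ℤ.+ m ≡ ℤ.+ n
  [m+n]-m m n = ≡.trans (ℤ.m-n≡m⊖n (m ℕ.+ n) m)
    (≡.trans (ℤ.⊖-≥ (ℕ.m≤m+n m n)) (≡.cong ℤ.+_ (ℕ.m+n∸m≡n m n)))

  -- At m = 0 the lower index is -1 and the convention gives 0, also when s = 0 and the upper index
  -- is -1. This agrees with the default of `delay`.
  delayed-gauss-represents : ∀ m s →
    [ ℤ.+ (m ℕ.+ s) ℤ.- 1ℤ , ℤ.+ m ℤ.- 1ℤ ]q² represents delay (λ m → gauss m s) m
  delayed-gauss-represents ℕ.zero s = fromDomain-represents P.0#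
  delayed-gauss-represents (suc m) s = gauss-represents m s

  factors-represent : ∀ i m s →
    ([ ℤ.+ (i ℕ.+ m ℕ.+ s) ℤ.- ℤ.+ i , ℤ.+ (i ℕ.+ m) ℤ.- ℤ.+ i ]q²
      + t * [ ℤ.+ (i ℕ.+ m ℕ.+ s) ℤ.- ℤ.+ i ℤ.- 1ℤ , ℤ.+ (i ℕ.+ m) ℤ.- ℤ.+ i ℤ.- 1ℤ ]q²)
    represents (gauss m s P.+ P.t P.* delay (λ m → gauss m s) m)
  factors-represent i m s = ≡.subst₂
    (λ n l → ([ n , l ]q² + t * [ n ℤ.- 1ℤ , l ℤ.- 1ℤ ]q²)
      represents (gauss m s P.+ P.t P.* delay (λ m → gauss m s) m))
    (≡.sym (≡.trans (≡.cong (λ n → ℤ.+ n ℤ.- ℤ.+ i) (ℕ.+-assoc i m s)) ([m+n]-m i (m ℕ.+ s))))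
    (≡.sym ([m+n]-m i m))
    (+-represents (gauss-represents m s)
      (*-represents (fromDomain-represents P.t) (delayed-gauss-represents m s)))

  summand-represents : ∀ k j s i m → j ℕ.+ s ≡ k → i ℕ.+ m ≡ j →
    ((- 1#) ^ (j ℕ.+ i) * t ^ (2 ℕ.* i) * q ^ (j ℕ.^ 2 ℕ.+ i ℕ.^ 2 ℕ.+ i)
      * [ ℤ.+ k ℤ.- ℤ.+ j , ℤ.+ i ]q²
      * ([ ℤ.+ k ℤ.- ℤ.+ i , ℤ.+ j ℤ.- ℤ.+ i ]q²
          + t * [ ℤ.+ k ℤ.- ℤ.+ i ℤ.- 1ℤ , ℤ.+ j ℤ.- ℤ.+ i ℤ.- 1ℤ ]q²))
    represents (coefficient j i P.* binomial s i P.*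
      (gauss m s P.+ P.t P.* delay (λ m → gauss m s) m))
  summand-represents _ _ s i m ≡.refl ≡.refl = *-represents
    (*-represents
      (*-represents (*-represents
        (^-represents (i ℕ.+ m ℕ.+ i) (-‿represents (fromDomain-represents P.1#)))
        (^-represents (2 ℕ.* i) (fromDomain-represents P.t)))
        (^-represents ((i ℕ.+ m) ℕ.^ 2 ℕ.+ i ℕ.^ 2 ℕ.+ i) (fromDomain-represents P.q)))
      (≡.subst (λ n → [ n , ℤ.+ i ]q² represents binomial s i)
        (≡.sym ([m+n]-m (i ℕ.+ m) s)) (binomial-represents s i)))
    (factors-represent i m s)

corollary1p2 : (k : ℕ) →
    T k ≈ ∑[ j ≤ k ] ∑[ i ≤ j ]
    ((- 1#) ^ (j ℕ.+ i) * t ^ (2 ℕ.* i) * q ^ (j ℕ.^ 2 ℕ.+ i ℕ.^ 2 ℕ.+ i)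
    * [ ℤ.+ k ℤ.- ℤ.+ j , ℤ.+ i ]q²
    * ([ ℤ.+ k ℤ.- ℤ.+ i , ℤ.+ j ℤ.- ℤ.+ i ]q²
    + t * [ ℤ.+ k ℤ.- ℤ.+ i ℤ.- 1ℤ , ℤ.+ j ℤ.- ℤ.+ i ℤ.- 1ℤ ]q²))
-- The double sum of fractions represents the polynomial double sum, with s = k - j and m = j - i,
-- and hence T_k itself.
corollary1p2 k = represents⇒≈ (represents-cong (P.sym (T≈doubleSum k))
  (∑-represents k (λ j → ∑≤ j (term j)) (λ j s → antidiagonal (polynomialTerm j s) j) λ j s j+s≡k →
    ∑-represents j (term j) (polynomialTerm j s) λ i m i+m≡j →
      summand-represents k j s i m j+s≡k i+m≡j))
  where
  term : ℕ → ℕ → Fraction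
  term j i = (- 1#) ^ (j ℕ.+ i) * t ^ (2 ℕ.* i) * q ^ (j ℕ.^ 2 ℕ.+ i ℕ.^ 2 ℕ.+ i)
    * [ ℤ.+ k ℤ.- ℤ.+ j , ℤ.+ i ]q²
    * ([ ℤ.+ k ℤ.- ℤ.+ i , ℤ.+ j ℤ.- ℤ.+ i ]q²
        + t * [ ℤ.+ k ℤ.- ℤ.+ i ℤ.- 1ℤ , ℤ.+ j ℤ.- ℤ.+ i ℤ.- 1ℤ ]q²)
  polynomialTerm : (j s i m : ℕ) → P.Carrier
  polynomialTerm j s i m =
    coefficient j i P.* binomial s i P.* (gauss m s P.+ P.t P.* delay (λ m → gauss m s) m)
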